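{- Let $\mu$ be a full Borel probability measure on the Cantor space $2^{\mathbb{N}}$. Then $\mu$ is good if and only if $\mu$ is both ultrahomogeneous and maximal.
   Context: All measures are Borel probability measures; $2^{\mathbb{N}}$ is the Cantor space. A measure is full if it is positive on every nonempty open set. $V_\mu=\{\mu(U): U\subseteq 2^{\mathbb{N}}\text{ clopen}\}$ is the clopen values set of $\mu$. A full measure $\mu$ on $2^{\mathbb{N}}$ is good if it satisfies the Subset Condition: whenever $U,V$ are clopen with $\mu(U)<\mu(V)$, there is a clopen $W\subseteq V$ with $\mu(W)=\mu(U)$ (such a measure is automatically nonatomic). $\mathrm{Homeo}(2^{\mathbb{N}},\mu)$ is the group of homeomorphisms of $2^{\mathbb{N}}$ preserving $\mu$. A clopen partition is a finite partition of $2^{\mathbb{N}}$ into nonempty clopen sets. A full measure $\mu$ is ultrahomogeneous if for any clopen partitions $P,R$ and any bijection $f\colon P\to R$ with $\mu(x)=\mu(f(x))$ for all $x\in P$, there is $\varphi\in\mathrm{Homeo}(2^{\mathbb{N}},\mu)$ with $\varphi[x]=f(x)$ for every $x\in P$. A measure $\mu$ is maximal if (i) for every tuple $v_1,\dots,v_n$ of non-zero elements of $V_\mu$ with $\sum_{i=1}^n v_i=1$ there is a clopen partition $\{x_1,\dots,x_n\}$ of $2^{\mathbb{N}}$ with $\mu(x_i)=v_i$ for $1\le i\le n$, and (ii) $|v-w|\in V_\mu$ for all $v,w\in V_\mu$. -}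

module Defs where

open import Level using (0ℓ; suc)
open import Data.Bool.Base using (Bool)
open import Data.Fin.Base using (Fin; toℕ)
open import Data.Nat.Base as ℕ using (ℕ)
import Data.Nat.Properties as ℕ
open import Data.Product.Base using (∃-syntax; Σ-syntax; _×_; _,_)
open import Data.Rational.Base as ℚ using (ℚ; 0ℚ; 1ℚ; ½)
import Data.Rational.Properties as ℚ
open import Data.Rational.Solver using (module +-*-Solver)
open import Data.Sum.Base using (inj₁; inj₂)
open import Data.Vec.Functional using (foldr)
open import Function.Bundles using (_⤖_; Bijection; Inverse)
open import Relation.Binary.Bundles using (Setoid)
open import Relation.Binary.PropositionalEquality
  using (_≡_; _≢_; refl; sym; cong; subst; _≗_; _→-setoid_)
open import Relation.Nullary.Negation.Core using (¬_)
open import Relation.Unary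
  using (Pred; _∈_; _⊆_; _≐_; _⊥_; _⊢_; ∅; U; ∁; ⋃; Satisfiable)

-- The standard library has no real numbers.  Here they are Cauchy
-- sequences of rationals, and x ≈ y says that the difference tends to 0.

IsCauchy : (ℕ → ℚ) → Set
IsCauchy s = ∀ ε → 0ℚ ℚ.< ε →
  ∃[ N ] ∀ m n → N ℕ.≤ m → N ℕ.≤ n → ℚ.∣ s m ℚ.- s n ∣ ℚ.< ε

record ℝ : Set where
  constructor mkℝ
  field
    seq    : ℕ → ℚ
    cauchy : IsCauchy seq

open ℝ public

infix 4 _≈_ _<_ _≤_

_≈_ : ℝ → ℝ → Set
x ≈ y = ∀ ε → 0ℚ ℚ.< ε →
  ∃[ N ] ∀ n → N ℕ.≤ n → ℚ.∣ seq x n ℚ.- seq y n ∣ ℚ.< ε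

_<_ : ℝ → ℝ → Set
x < y = Σ[ ε ∈ ℚ ] 0ℚ ℚ.< ε ×
  (∃[ N ] ∀ n → N ℕ.≤ n → seq x n ℚ.+ ε ℚ.< seq y n)

_≤_ : ℝ → ℝ → Set
x ≤ y = ¬ (y < x)

private
  0<½* : ∀ {ε} → 0ℚ ℚ.< ε → 0ℚ ℚ.< ½ ℚ.* ε
  0<½* {ε} 0<ε = subst (ℚ._< ½ ℚ.* ε) (ℚ.*-zeroʳ ½) (ℚ.*-monoʳ-<-pos ½ 0<ε)

  halves : ∀ ε → ½ ℚ.* ε ℚ.+ ½ ℚ.* ε ≡ ε
  halves = solve 1 (λ e → con ½ :* e :+ con ½ :* e := e) refl
    where open +-*-Solver

  +-swap : ∀ a b c d → (a ℚ.+ b) ℚ.- (c ℚ.+ d) ≡ (a ℚ.- c) ℚ.+ (b ℚ.- d)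
  +-swap = solve 4 (λ a b c d → (a :+ b) :- (c :+ d) := (a :- c) :+ (b :- d)) refl
    where open +-*-Solver

  neg-swap : ∀ a b → (ℚ.- a) ℚ.- (ℚ.- b) ≡ ℚ.- (a ℚ.- b)
  neg-swap = solve 2 (λ a b → (:- a) :- (:- b) := :- (a :- b)) refl
    where open +-*-Solver

  sub-add : ∀ a b → (a ℚ.- b) ℚ.+ b ≡ a
  sub-add = solve 2 (λ a b → (a :- b) :+ b := a) refl
    where open +-*-Solver

  add-sub : ∀ a b → (a ℚ.+ b) ℚ.- b ≡ a
  add-sub = solve 2 (λ a b → (a :+ b) :- b := a) refl
    where open +-*-Solver

  neg-sub : ∀ a b → ℚ.- (a ℚ.- b) ≡ b ℚ.- a
  neg-sub = solve 2 (λ a b → :- (a :- b) := b :- a) refl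
    where open +-*-Solver

  ∣a∣-∣b∣≤ : ∀ a b → ℚ.∣ a ∣ ℚ.- ℚ.∣ b ∣ ℚ.≤ ℚ.∣ a ℚ.- b ∣
  ∣a∣-∣b∣≤ a b = begin
    ℚ.∣ a ∣ ℚ.- ℚ.∣ b ∣
      ≡⟨ cong (λ t → ℚ.∣ t ∣ ℚ.- ℚ.∣ b ∣) (sub-add a b) ⟨
    ℚ.∣ (a ℚ.- b) ℚ.+ b ∣ ℚ.- ℚ.∣ b ∣
      ≤⟨ ℚ.+-monoˡ-≤ (ℚ.- ℚ.∣ b ∣) (ℚ.∣p+q∣≤∣p∣+∣q∣ (a ℚ.- b) b) ⟩
    (ℚ.∣ a ℚ.- b ∣ ℚ.+ ℚ.∣ b ∣) ℚ.- ℚ.∣ b ∣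
      ≡⟨ add-sub ℚ.∣ a ℚ.- b ∣ ℚ.∣ b ∣ ⟩
    ℚ.∣ a ℚ.- b ∣ ∎
    where open ℚ.≤-Reasoning

  ∣∣a∣-∣b∣∣≤ : ∀ a b → ℚ.∣ ℚ.∣ a ∣ ℚ.- ℚ.∣ b ∣ ∣ ℚ.≤ ℚ.∣ a ℚ.- b ∣
  ∣∣a∣-∣b∣∣≤ a b with ℚ.∣p∣≡p∨∣p∣≡-p (ℚ.∣ a ∣ ℚ.- ℚ.∣ b ∣)
  ... | inj₁ eq = subst (ℚ._≤ ℚ.∣ a ℚ.- b ∣) (sym eq) (∣a∣-∣b∣≤ a b)
  ... | inj₂ eq = begin
    ℚ.∣ ℚ.∣ a ∣ ℚ.- ℚ.∣ b ∣ ∣   ≡⟨ eq ⟩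
    ℚ.- (ℚ.∣ a ∣ ℚ.- ℚ.∣ b ∣)   ≡⟨ neg-sub ℚ.∣ a ∣ ℚ.∣ b ∣ ⟩
    ℚ.∣ b ∣ ℚ.- ℚ.∣ a ∣         ≤⟨ ∣a∣-∣b∣≤ b a ⟩
    ℚ.∣ b ℚ.- a ∣               ≡⟨ cong ℚ.∣_∣ (neg-sub a b) ⟨
    ℚ.∣ ℚ.- (a ℚ.- b) ∣         ≡⟨ ℚ.∣-p∣≡∣p∣ (a ℚ.- b) ⟩
    ℚ.∣ a ℚ.- b ∣               ∎
    where open ℚ.≤-Reasoning

fromℚ : ℚ → ℝ
seq    (fromℚ q) _ = q
cauchy (fromℚ q) ε 0<ε = 0 , λ _ _ _ _ →
  subst (λ t → ℚ.∣ t ∣ ℚ.< ε) (sym (ℚ.+-inverseʳ q)) 0<ε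

0ℝ 1ℝ : ℝ
0ℝ = fromℚ 0ℚ
1ℝ = fromℚ 1ℚ

infixl 6 _+_ _-_
infix  8 -_

_+_ : ℝ → ℝ → ℝ
seq    (x + y) n = seq x n ℚ.+ seq y n
cauchy (x + y) ε 0<ε
  with cauchy x (½ ℚ.* ε) (0<½* 0<ε) | cauchy y (½ ℚ.* ε) (0<½* 0<ε)
... | M , p | N , q = M ℕ.⊔ N , λ m n ≤m ≤n →
  let open ℚ.≤-Reasoning in begin-strict
    ℚ.∣ (seq x m ℚ.+ seq y m) ℚ.- (seq x n ℚ.+ seq y n) ∣
      ≡⟨ cong ℚ.∣_∣ (+-swap (seq x m) (seq y m) (seq x n) (seq y n)) ⟩
    ℚ.∣ (seq x m ℚ.- seq x n) ℚ.+ (seq y m ℚ.- seq y n) ∣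
      ≤⟨ ℚ.∣p+q∣≤∣p∣+∣q∣ (seq x m ℚ.- seq x n) (seq y m ℚ.- seq y n) ⟩
    ℚ.∣ seq x m ℚ.- seq x n ∣ ℚ.+ ℚ.∣ seq y m ℚ.- seq y n ∣
      <⟨ ℚ.+-mono-<
           (p m n (ℕ.m⊔n≤o⇒m≤o M N ≤m) (ℕ.m⊔n≤o⇒m≤o M N ≤n))
           (q m n (ℕ.m⊔n≤o⇒n≤o M N ≤m) (ℕ.m⊔n≤o⇒n≤o M N ≤n)) ⟩
    ½ ℚ.* ε ℚ.+ ½ ℚ.* ε
      ≡⟨ halves ε ⟩
    ε ∎

-_ : ℝ → ℝ
seq    (- x) n = ℚ.- seq x n
cauchy (- x) ε 0<ε with cauchy x ε 0<ε
... | N , p = N , λ m n ≤m ≤n →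
  let open ℚ.≤-Reasoning in begin-strict
    ℚ.∣ (ℚ.- seq x m) ℚ.- (ℚ.- seq x n) ∣ ≡⟨ cong ℚ.∣_∣ (neg-swap (seq x m) (seq x n)) ⟩
    ℚ.∣ ℚ.- (seq x m ℚ.- seq x n) ∣       ≡⟨ ℚ.∣-p∣≡∣p∣ (seq x m ℚ.- seq x n) ⟩
    ℚ.∣ seq x m ℚ.- seq x n ∣             <⟨ p m n ≤m ≤n ⟩
    ε                                     ∎

_-_ : ℝ → ℝ → ℝ
x - y = x + (- y)

∣_∣ : ℝ → ℝ
seq    ∣ x ∣ n = ℚ.∣ seq x n ∣
cauchy ∣ x ∣ ε 0<ε with cauchy x ε 0<ε
... | N , p = N , λ m n ≤m ≤n →
  ℚ.≤-<-trans (∣∣a∣-∣b∣∣≤ (seq x m) (seq x n)) (p m n ≤m ≤n)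

∑ : ∀ {n} → (Fin n → ℝ) → ℝ
∑ = foldr _+_ 0ℝ

infix 4 _⟶_

_⟶_ : (ℕ → ℝ) → ℝ → Set
s ⟶ l = ∀ ε → 0ℝ < ε → ∃[ N ] ∀ n → N ℕ.≤ n → ∣ s n - l ∣ < ε

HasSum : (ℕ → ℝ) → ℝ → Set
HasSum a l = (λ n → ∑ {n} (λ i → a (toℕ i))) ⟶ l

-- Points of Cantor space are compared pointwise (_≗_), since function
-- extensionality is unavailable; open sets, and hence Borel sets, are
-- automatically invariant under this equality.

𝟚ᴺ : Set
𝟚ᴺ = ℕ → Bool

𝟚ᴺ-setoid : Setoid 0ℓ 0ℓ
𝟚ᴺ-setoid = ℕ →-setoid Bool

Subset : Set₁
Subset = Pred 𝟚ᴺ 0ℓ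

-- y lies in the basic open set of sequences agreeing with x below n.

Agree : ℕ → 𝟚ᴺ → 𝟚ᴺ → Set
Agree n x y = ∀ i → i ℕ.< n → x i ≡ y i

IsOpen : Subset → Set
IsOpen A = ∀ x → x ∈ A → ∃[ n ] ∀ y → Agree n x y → y ∈ A

IsClosed : Subset → Set
IsClosed A = IsOpen (∁ A)

Continuous : (𝟚ᴺ → 𝟚ᴺ) → Set₁
Continuous f = ∀ {A : Subset} → IsOpen A → IsOpen (f ⊢ A)

image : (𝟚ᴺ → 𝟚ᴺ) → Subset → Subset
image f A y = ∃[ x ] x ∈ A × f x ≗ y

record Clopen : Set₁ where
  field
    set      : Subset
    isOpen   : IsOpen set
    isClosed : IsClosed set

-- Membership in the σ-algebra generated by the open sets; the last
-- constructor is needed because subsets with the same elements need not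
-- be propositionally equal.

data IsBorel : Subset → Set₁ where
  open-set   : ∀ {A} → IsOpen A → IsBorel A
  complement : ∀ {A} → IsBorel A → IsBorel (∁ A)
  union      : ∀ {A : ℕ → Subset} → (∀ n → IsBorel (A n)) → IsBorel (⋃ ℕ A)
  respects   : ∀ {A B} → A ≐ B → IsBorel A → IsBorel B

record BorelSet : Set₁ where
  field
    set     : Subset
    isBorel : IsBorel set

∅ᴮ Uᴮ : BorelSet
∅ᴮ = record { set = ∅ ; isBorel = open-set λ _ () }
Uᴮ = record { set = U ; isBorel = open-set λ _ _ → 0 , λ _ _ → _ }

⋃ᴮ : (ℕ → BorelSet) → BorelSet
⋃ᴮ A = record
  { set     = ⋃ ℕ (λ n → BorelSet.set (A n))
  ; isBorel = union (λ n → BorelSet.isBorel (A n))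
  }

clopen⇒borel : Clopen → BorelSet
clopen⇒borel V = record { set = Clopen.set V ; isBorel = open-set (Clopen.isOpen V) }

preimage-isBorel : ∀ {f} → Continuous f → ∀ {A} → IsBorel A → IsBorel (f ⊢ A)
preimage-isBorel f-cont (open-set o)         = open-set (f-cont o)
preimage-isBorel f-cont (complement b)       = complement (preimage-isBorel f-cont b)
preimage-isBorel f-cont (union b)            = union (λ n → preimage-isBorel f-cont (b n))
preimage-isBorel f-cont (respects (p , q) b) = respects (p , q) (preimage-isBorel f-cont b)

preimage : ∀ {f} → Continuous f → BorelSet → BorelSet
preimage {f} f-cont A = record
  { set     = f ⊢ BorelSet.set A
  ; isBorel = preimage-isBorel f-cont (BorelSet.isBorel A)
  }

record ProbabilityMeasure : Set₁ where
  field
    measure           : BorelSet → ℝ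
    measure-cong      : ∀ {A B} → BorelSet.set A ≐ BorelSet.set B → measure A ≈ measure B
    nonnegative       : ∀ A → 0ℝ ≤ measure A
    measure-∅         : measure ∅ᴮ ≈ 0ℝ
    measure-U         : measure Uᴮ ≈ 1ℝ
    countablyAdditive : ∀ (A : ℕ → BorelSet) →
      (∀ {m n} → m ≢ n → BorelSet.set (A m) ⊥ BorelSet.set (A n)) →
      HasSum (λ n → measure (A n)) (measure (⋃ᴮ A))

  measureᶜ : Clopen → ℝ
  measureᶜ V = measure (clopen⇒borel V)

open ProbabilityMeasure public

Full : ProbabilityMeasure → Set₁
Full μ = ∀ (A : Subset) (A-open : IsOpen A) → Satisfiable A →
  0ℝ < measure μ (record { set = A ; isBorel = open-set A-open })

ClopenValues : ProbabilityMeasure → Pred ℝ (suc 0ℓ)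
ClopenValues μ v = Σ[ V ∈ Clopen ] measureᶜ μ V ≈ v

SubsetCondition : ProbabilityMeasure → Set₁
SubsetCondition μ = ∀ (A B : Clopen) → measureᶜ μ A < measureᶜ μ B →
  Σ[ W ∈ Clopen ] Clopen.set W ⊆ Clopen.set B × measureᶜ μ W ≈ measureᶜ μ A

Good : ProbabilityMeasure → Set₁
Good μ = Full μ × SubsetCondition μ

record Homeo (μ : ProbabilityMeasure) : Set₁ where
  field
    inverse         : Inverse 𝟚ᴺ-setoid 𝟚ᴺ-setoid
  open Inverse inverse public using (to; from)
  field
    to-continuous   : Continuous to
    from-continuous : Continuous from
    preserves       : ∀ A → measure μ (preimage to-continuous A) ≈ measure μ A

-- The n members of a partition are nonempty and pairwise disjoint, hence
-- distinct, so maps between partitions are maps between their index sets.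

record ClopenPartition (n : ℕ) : Set₁ where
  field
    part     : Fin n → Clopen
    nonempty : ∀ i → Satisfiable (Clopen.set (part i))
    disjoint : ∀ {i j} → i ≢ j → Clopen.set (part i) ⊥ Clopen.set (part j)
    covers   : ∀ x → ∃[ i ] x ∈ Clopen.set (part i)

open ClopenPartition public

Ultrahomogeneous : ProbabilityMeasure → Set₁
Ultrahomogeneous μ = Full μ ×
  (∀ {m n} (P : ClopenPartition m) (R : ClopenPartition n) (f : Fin m ⤖ Fin n) →
   let open Bijection f using () renaming (to to f⟨_⟩) in
   (∀ i → measureᶜ μ (part P i) ≈ measureᶜ μ (part R f⟨ i ⟩)) →
   Σ[ φ ∈ Homeo μ ] ∀ i →
     image (Homeo.to φ) (Clopen.set (part P i)) ≐ Clopen.set (part R f⟨ i ⟩))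

record Maximal (μ : ProbabilityMeasure) : Set₁ where
  field
    realizes   : ∀ {n} (v : Fin n → ℝ) →
      (∀ i → v i ∈ ClopenValues μ) → (∀ i → ¬ (v i ≈ 0ℝ)) → ∑ v ≈ 1ℝ →
      Σ[ P ∈ ClopenPartition n ] ∀ i → measureᶜ μ (part P i) ≈ v i
    difference : ∀ v w → v ∈ ClopenValues μ → w ∈ ClopenValues μ →
      ∣ v - w ∣ ∈ ClopenValues μ

{-# OPTIONS --safe #-}

-- Good ⇒ ultrahomogeneous: by the subset condition, whenever μ(V) = μ(W) a cut
-- of V by a clopen set can be copied by a cut of W into pieces of the same
-- measures.  Going back and forth, one refines the given matched partitions to
-- two trees of clopen cells, indexed by the same nodes, in which corresponding
-- cells have equal measure and in which the n-th step of a path records the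
-- n-th bit of the points of its left cell and of its right cell.  By fullness
-- corresponding cells are both empty or both nonempty, so every left path is a
-- right path, and reading off the right bits along the path of x is a
-- homeomorphism carrying left cells to right cells.  It preserves the measure of
-- every set determined by finitely many bits, hence of every Borel set, since
-- each Borel set differs from such a set within a Borel set of small measure.
--
-- Conversely, given 0 < a = μ(A) < b = μ(B) < 1, maximality yields a partition
-- with measures a, b − a and 1 − b; an automorphism carrying the union of the
-- first two members onto B maps the first member to the required subset of B.

module Submission where

open import Level using (0ℓ)
open import Axiom.ExcludedMiddle using (ExcludedMiddle)
open import Data.Bool.Base using (Bool; true; false)
open import Data.Empty using (⊥-elim)
open import Data.Fin.Base using (Fin; toℕ; zero; suc)
open import Data.Integer.Base using (+_)
open import Data.Nat.Base as ℕ using (ℕ; zero; suc; z≤n; s≤s)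
import Data.Nat.Properties as ℕ
open import Data.Product.Base using (∃-syntax; Σ-syntax; _×_; _,_; proj₁; proj₂)
open import Data.Rational.Base as ℚ using (ℚ; 0ℚ; ½)
import Data.Rational.Properties as ℚ
open import Data.Rational.Solver using (module +-*-Solver)
open import Data.Sum.Base using (inj₁; inj₂)
open import Function.Base using (_∘_; id)
open import Function.Bundles using (Inverse; _⤖_; Bijection; _⇔_; mk⇔)
open import Function.Construct.Identity using (⤖-id)
open import Relation.Binary.Bundles using (Setoid; Preorder)
open import Relation.Binary.Definitions using (tri<; tri≈; tri>)
open import Relation.Binary.PropositionalEquality
  using (_≡_; _≢_; refl; sym; trans; cong; subst; subst₂; _≗_)
import Relation.Binary.Reasoning.Preorder as PreorderReasoning
open import Relation.Nullary.Decidable.Core using (Dec; yes; no)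
open import Relation.Nullary.Negation.Core using (¬_)
open import Relation.Unary using (_∈_; _∉_; _⊆_; _≐_; _⊥_; _⊢_; _∪_; _∩_; ∅; ∁; Satisfiable)
open import Defs

-- Order and addition on the reals

scaled-pos : ∀ r .{{_ : ℚ.Positive r}} {ε} → 0ℚ ℚ.< ε → 0ℚ ℚ.< r ℚ.* ε
scaled-pos r {ε} 0<ε = subst (ℚ._< r ℚ.* ε) (ℚ.*-zeroʳ r) (ℚ.*-monoʳ-<-pos r 0<ε)

½-pos : ∀ {ε} → 0ℚ ℚ.< ε → 0ℚ ℚ.< ½ ℚ.* ε
½-pos = scaled-pos ½

shift-< : ∀ {p q} a b t → p ℚ.< q → a ℚ.+ t ≡ p → b ℚ.+ t ≡ q → a ℚ.< b
shift-< a b t p<q refl refl =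
  subst₂ ℚ._<_ (cancel a t) (cancel b t) (ℚ.+-monoˡ-< (ℚ.- t) p<q)
  where
  open +-*-Solver
  cancel : ∀ a t → (a ℚ.+ t) ℚ.- t ≡ a
  cancel = solve 2 (λ a t → (a :+ t) :- t := a) refl

∣-∣<⇒<+ : ∀ a b {ε} → ℚ.∣ a ℚ.- b ∣ ℚ.< ε → a ℚ.< b ℚ.+ ε
∣-∣<⇒<+ a b {ε} h =
  shift-< a (b ℚ.+ ε) (ℚ.- b)
    (ℚ.≤-<-trans (p≤∣p∣ (a ℚ.- b)) h)
    refl
    (solve 2 (λ b e → (b :+ e) :- b := e) refl b ε)
  where
  open +-*-Solver
  p≤∣p∣ : ∀ p → p ℚ.≤ ℚ.∣ p ∣
  p≤∣p∣ p with ℚ.≤-total 0ℚ p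
  ... | inj₁ 0≤p = ℚ.≤-reflexive (sym (ℚ.0≤p⇒∣p∣≡p 0≤p))
  ... | inj₂ p≤0 = ℚ.≤-trans p≤0 (ℚ.0≤∣p∣ p)

∣-∣-comm : ∀ a b → ℚ.∣ a ℚ.- b ∣ ≡ ℚ.∣ b ℚ.- a ∣
∣-∣-comm a b = trans (sym (ℚ.∣-p∣≡∣p∣ (a ℚ.- b)))
  (cong ℚ.∣_∣ (solve 2 (λ a b → :- (a :- b) := b :- a) refl a b))
  where open +-*-Solver

<+⇒∣-∣< : ∀ a b {ε} → a ℚ.< b ℚ.+ ε → b ℚ.< a ℚ.+ ε → ℚ.∣ a ℚ.- b ∣ ℚ.< ε
<+⇒∣-∣< a b {ε} h k with ℚ.∣p∣≡p∨∣p∣≡-p (ℚ.- b ℚ.+ a)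
... | inj₁ e = subst (ℚ._< ε) (sym (trans (cong ℚ.∣_∣ (ℚ.+-comm a (ℚ.- b))) e))
        (shift-< (ℚ.- b ℚ.+ a) ε b h
          (solve 2 (λ a b → ((:- b) :+ a) :+ b := a) refl a b) (ℚ.+-comm ε b))
  where open +-*-Solver
... | inj₂ e = subst (ℚ._< ε) (sym (trans (cong ℚ.∣_∣ (ℚ.+-comm a (ℚ.- b))) e))
        (shift-< (ℚ.- (ℚ.- b ℚ.+ a)) ε a k
          (solve 2 (λ a b → (:- ((:- b) :+ a)) :+ a := b) refl a b) (ℚ.+-comm ε a))
  where open +-*-Solver

Eventually : (ℕ → Set) → Set
Eventually P = ∃[ N ] ∀ n → N ℕ.≤ n → P n

eventually₁ : ∀ {P Q : ℕ → Set} → (∀ n → P n → Q n) → Eventually P → Eventually Q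
eventually₁ f (N , p) = N , λ n ≤n → f n (p n ≤n)

eventually₂ : ∀ {P Q R : ℕ → Set} → (∀ n → P n → Q n → R n) →
  Eventually P → Eventually Q → Eventually R
eventually₂ f (M , p) (N , q) = M ℕ.⊔ N , λ n ≤n →
  f n (p n (ℕ.m⊔n≤o⇒m≤o M N ≤n)) (q n (ℕ.m⊔n≤o⇒n≤o M N ≤n))

-- The relations on ℝ unfold to statements about sequences, from which
-- Agda cannot recover the two numbers; wrapping them in records cures this.

infix 4 _≼_ _≺_ _≃_

record _≼_ (x y : ℝ) : Set where
  constructor mk≼
  field within : ∀ ε → 0ℚ ℚ.< ε → Eventually λ n → seq x n ℚ.< seq y n ℚ.+ ε
open _≼_

record _≺_ (x y : ℝ) : Set where
  constructor mk≺
  field unwrap : x < y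
open _≺_

record _≃_ (x y : ℝ) : Set where
  constructor _,_
  field
    ≃⇒≼ : x ≼ y
    ≃⇒≽ : y ≼ x
open _≃_

-- Rational comparison at a single index `K` past both Cauchy moduli decides the matter. If `x`
-- stays below `y` plus `4δ` there, each sequence drifts by less than `δ` afterwards, giving
-- `6δ = ε` in total. If not, the drift still leaves `x` above `y` by more than `δ` from `K` on,
-- which is a witness of `y < x`.
≤⇒≼ : ∀ x y → x ≤ y → x ≼ y
≤⇒≼ x y x≤y = mk≼ λ ε 0<ε →
  by-cases ε 0<ε (cauchy x _ (scaled-pos ⅙ 0<ε)) (cauchy y _ (scaled-pos ⅙ 0<ε))
  where
  open +-*-Solver
  ⅙ = (+ 1) ℚ./ 6
  module _ (ε : ℚ) (0<ε : 0ℚ ℚ.< ε) where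
    δ = ⅙ ℚ.* ε
    4δ = δ ℚ.+ δ ℚ.+ (δ ℚ.+ δ)
    by-cases : (∃[ M ] ∀ m n → M ℕ.≤ m → M ℕ.≤ n → ℚ.∣ seq x m ℚ.- seq x n ∣ ℚ.< δ) →
               (∃[ N ] ∀ m n → N ℕ.≤ m → N ℕ.≤ n → ℚ.∣ seq y m ℚ.- seq y n ∣ ℚ.< δ) →
               Eventually λ n → seq x n ℚ.< seq y n ℚ.+ ε
    by-cases (M , p) (N , q) with seq x (M ℕ.⊔ N) ℚ.<? seq y (M ℕ.⊔ N) ℚ.+ 4δ
    ... | yes h = K , λ n ≤n →
          shift-< (seq x n) (seq y n ℚ.+ ε) (xK ℚ.+ yK)
            (ℚ.+-mono-< h (ℚ.+-mono-<
              (∣-∣<⇒<+ (seq x n) xK (p n K (ℕ.m⊔n≤o⇒m≤o M N ≤n) (ℕ.m≤m⊔n M N)))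
              (∣-∣<⇒<+ yK (seq y n) (q K n (ℕ.m≤n⊔m M N) (ℕ.m⊔n≤o⇒n≤o M N ≤n)))))
            (solve 3 (λ u x y → u :+ (x :+ y) := x :+ (u :+ y)) refl (seq x n) xK yK)
            (solve 4 (λ u e x y →
                let d = con ⅙ :* e in
                (u :+ e) :+ (x :+ y) := (y :+ (d :+ d :+ (d :+ d))) :+ ((x :+ d) :+ (u :+ d)))
              refl (seq y n) ε xK yK)
      where K = M ℕ.⊔ N ; xK = seq x K ; yK = seq y K
    ... | no ¬h = ⊥-elim (x≤y (δ , scaled-pos ⅙ 0<ε , K , λ n ≤n →
          shift-< (seq y n ℚ.+ δ) (seq x n) (xK ℚ.+ yK ℚ.+ (δ ℚ.+ (δ ℚ.+ δ)))
            (ℚ.+-mono-≤-< (ℚ.≮⇒≥ ¬h) (ℚ.+-mono-<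
              (∣-∣<⇒<+ xK (seq x n) (p K n (ℕ.m≤m⊔n M N) (ℕ.m⊔n≤o⇒m≤o M N ≤n)))
              (ℚ.<-trans (∣-∣<⇒<+ (seq y n) yK (q n K (ℕ.m⊔n≤o⇒n≤o M N ≤n) (ℕ.m≤n⊔m M N)))
                (pad (yK ℚ.+ δ)))))
            (solve 4 (λ d u x y → (u :+ d) :+ (x :+ y :+ (d :+ (d :+ d))) :=
                (y :+ (d :+ d :+ (d :+ d))) :+ (x :+ u)) refl δ (seq y n) xK yK)
            (solve 4 (λ d u x y → u :+ (x :+ y :+ (d :+ (d :+ d))) :=
                x :+ ((u :+ d) :+ (y :+ d :+ d))) refl δ (seq x n) xK yK)))
      where
      K = M ℕ.⊔ N
      xK = seq x K
      yK = seq y K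
      pad : ∀ a → a ℚ.< a ℚ.+ δ
      pad a = subst (ℚ._< a ℚ.+ δ) (ℚ.+-identityʳ a) (ℚ.+-monoʳ-< a (scaled-pos ⅙ 0<ε))

≼⇒≤ : ∀ {x y} → x ≼ y → x ≤ y
≼⇒≤ (mk≼ h) (ε , 0<ε , M , p) with h ε 0<ε
... | N , q = ℚ.<-asym (p (M ℕ.⊔ N) (ℕ.m≤m⊔n M N)) (q (M ℕ.⊔ N) (ℕ.m≤n⊔m M N))

≈⇒≃ : ∀ x y → x ≈ y → x ≃ y
≈⇒≃ x y h =
  mk≼ (λ ε 0<ε → eventually₁ (λ n → ∣-∣<⇒<+ (seq x n) (seq y n)) (h ε 0<ε)) ,
  mk≼ (λ ε 0<ε → eventually₁
        (λ n → ∣-∣<⇒<+ (seq y n) (seq x n) ∘ subst (ℚ._< ε) (∣-∣-comm (seq x n) (seq y n)))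
        (h ε 0<ε))

≃⇒≈ : ∀ {x y} → x ≃ y → x ≈ y
≃⇒≈ {x} {y} (mk≼ p , mk≼ q) ε 0<ε =
  eventually₂ (λ n → <+⇒∣-∣< (seq x n) (seq y n)) (p ε 0<ε) (q ε 0<ε)

≼-refl : ∀ {x} → x ≼ x
≼-refl {x} = mk≼ λ ε 0<ε → 0 , λ n _ →
  subst (ℚ._< seq x n ℚ.+ ε) (ℚ.+-identityʳ (seq x n)) (ℚ.+-monoʳ-< (seq x n) 0<ε)

pointwise : ∀ {x y} → (∀ n → seq x n ≡ seq y n) → x ≃ y
pointwise {x} {y} h =
  mk≼ (λ ε 0<ε → eventually₁ (λ n → subst (λ t → seq x n ℚ.< t ℚ.+ ε) (h n)) (within (≼-refl {x}) ε 0<ε)) ,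
  mk≼ (λ ε 0<ε → eventually₁ (λ n → subst (λ t → seq y n ℚ.< t ℚ.+ ε) (sym (h n))) (within (≼-refl {y}) ε 0<ε))

≼-trans : ∀ {x y z} → x ≼ y → y ≼ z → x ≼ z
≼-trans {x} {y} {z} (mk≼ p) (mk≼ q) = mk≼ λ ε 0<ε → eventually₂
  (λ n a b → shift-< (seq x n) (seq z n ℚ.+ ε) (seq y n) (ℚ.+-mono-< a b) refl
    (solve 3 (λ e y z → z :+ e :+ y := (y :+ con ½ :* e) :+ (z :+ con ½ :* e)) refl ε (seq y n) (seq z n)))
  (p (½ ℚ.* ε) (½-pos 0<ε)) (q (½ ℚ.* ε) (½-pos 0<ε))
  where open +-*-Solver

≼-≺-trans : ∀ {x y z} → x ≼ y → y ≺ z → x ≺ z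
≼-≺-trans {x} {y} {z} (mk≼ q) (mk≺ (ε , 0<ε , p)) = mk≺ (½ ℚ.* ε , ½-pos 0<ε , eventually₂
  (λ n a b → shift-< (seq x n ℚ.+ ½ ℚ.* ε) (seq z n) (seq y n ℚ.+ ½ ℚ.* ε) (ℚ.+-mono-< a b)
    (solve 3 (λ e x y → (x :+ con ½ :* e) :+ (y :+ con ½ :* e) := x :+ (y :+ e)) refl ε (seq x n) (seq y n))
    (ℚ.+-comm (seq z n) (seq y n ℚ.+ ½ ℚ.* ε)))
  (q (½ ℚ.* ε) (½-pos 0<ε)) p)
  where open +-*-Solver

≺-≼-trans : ∀ {x y z} → x ≺ y → y ≼ z → x ≺ z
≺-≼-trans {x} {y} {z} (mk≺ (ε , 0<ε , p)) (mk≼ q) = mk≺ (½ ℚ.* ε , ½-pos 0<ε , eventually₂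
  (λ n a b → shift-< (seq x n ℚ.+ ½ ℚ.* ε) (seq z n) (seq y n ℚ.+ ½ ℚ.* ε) (ℚ.+-mono-< a b)
    (solve 3 (λ e x y → (x :+ con ½ :* e) :+ (y :+ con ½ :* e) := (x :+ e) :+ y) refl ε (seq x n) (seq y n))
    (solve 3 (λ e y z → z :+ (y :+ con ½ :* e) := y :+ (z :+ con ½ :* e)) refl ε (seq y n) (seq z n)))
  p (q (½ ℚ.* ε) (½-pos 0<ε)))
  where open +-*-Solver

≺⇒≼ : ∀ {x y} → x ≺ y → x ≼ y
≺⇒≼ {x} {y} (mk≺ (ε , 0<ε , p)) = mk≼ λ δ 0<δ → eventually₁
  (λ n a → ℚ.<-trans (grow (seq x n) 0<ε) (ℚ.<-trans a (grow (seq y n) 0<δ))) p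
  where
  grow : ∀ a {e} → 0ℚ ℚ.< e → a ℚ.< a ℚ.+ e
  grow a {e} 0<e = subst (ℚ._< a ℚ.+ e) (ℚ.+-identityʳ a) (ℚ.+-monoʳ-< a 0<e)

≺⇒⋡ : ∀ {x y} → x ≺ y → ¬ (y ≼ x)
≺⇒⋡ (mk≺ p) q = ≼⇒≤ q p

≃-refl : ∀ {x} → x ≃ x
≃-refl = ≼-refl , ≼-refl

≃-sym : ∀ {x y} → x ≃ y → y ≃ x
≃-sym (p , q) = q , p

≃-trans : ∀ {x y z} → x ≃ y → y ≃ z → x ≃ z
≃-trans (p , q) (p′ , q′) = ≼-trans p p′ , ≼-trans q′ q

ℝ-setoid : Setoid 0ℓ 0ℓ
ℝ-setoid = record
  { Carrier = ℝ ; _≈_ = _≃_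
  ; isEquivalence = record { refl = ≃-refl ; sym = ≃-sym ; trans = ≃-trans } }

ℝ-preorder : Preorder 0ℓ 0ℓ 0ℓ
ℝ-preorder = record
  { Carrier = ℝ ; _≈_ = _≃_ ; _≲_ = _≼_
  ; isPreorder = record
    { isEquivalence = Setoid.isEquivalence ℝ-setoid ; reflexive = ≃⇒≼ ; trans = ≼-trans } }

module ≼-Reasoning = PreorderReasoning ℝ-preorder

-- Copattern-defined sums are unfolded by the conversion checker, Cauchy
-- moduli included; opacity prevents this.

infixl 6 _⊕_ _⊖_

opaque
  _⊕_ : ℝ → ℝ → ℝ
  x ⊕ y = x + y

  _⊖_ : ℝ → ℝ → ℝ
  x ⊖ y = x - y

  sum : ∀ {n} → (Fin n → ℝ) → ℝ
  sum = ∑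

opaque
  unfolding _⊕_ _⊖_ sum

  ⊖≃- : ∀ x y → x ⊖ y ≃ x - y
  ⊖≃- x y = pointwise λ _ → refl

  sum≃∑ : ∀ {n} (a : Fin n → ℝ) → sum a ≃ ∑ a
  sum≃∑ a = pointwise λ _ → refl

  sum-zero : ∀ (a : Fin 0 → ℝ) → sum a ≃ 0ℝ
  sum-zero a = pointwise λ _ → refl

  sum-suc : ∀ {n} (a : Fin (suc n) → ℝ) → sum a ≃ a zero ⊕ sum (a ∘ suc)
  sum-suc a = pointwise λ _ → refl

  ⊕-mono-≼ : ∀ {x y u v} → x ≼ y → u ≼ v → x ⊕ u ≼ y ⊕ v
  ⊕-mono-≼ {x} {y} {u} {v} (mk≼ p) (mk≼ q) = mk≼ λ ε 0<ε → eventually₂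
    (λ n a b → subst (seq x n ℚ.+ seq u n ℚ.<_)
      (solve 3 (λ e y v → (y :+ con ½ :* e) :+ (v :+ con ½ :* e) := (y :+ v) :+ e) refl ε (seq y n) (seq v n))
      (ℚ.+-mono-< a b))
    (p (½ ℚ.* ε) (½-pos 0<ε)) (q (½ ℚ.* ε) (½-pos 0<ε))
    where open +-*-Solver

  ⊕-comm : ∀ x y → x ⊕ y ≃ y ⊕ x
  ⊕-comm x y = pointwise λ n → ℚ.+-comm (seq x n) (seq y n)

  ⊕-assoc : ∀ x y z → (x ⊕ y) ⊕ z ≃ x ⊕ (y ⊕ z)
  ⊕-assoc x y z = pointwise λ n → ℚ.+-assoc (seq x n) (seq y n) (seq z n)

  ⊕-identityʳ : ∀ x → x ⊕ 0ℝ ≃ x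
  ⊕-identityʳ x = pointwise λ n → ℚ.+-identityʳ (seq x n)

  ⊖-mono-≼ : ∀ {x y z} → x ≼ y → x ⊖ z ≼ y ⊖ z
  ⊖-mono-≼ {x} {y} {z} (mk≼ p) = mk≼ λ ε 0<ε → eventually₁
    (λ n a → shift-< (seq x n ℚ.- seq z n) (seq y n ℚ.- seq z n ℚ.+ ε) (seq z n) a
      (solve 2 (λ x z → (x :- z) :+ z := x) refl (seq x n) (seq z n))
      (solve 3 (λ y z e → (y :- z :+ e) :+ z := y :+ e) refl (seq y n) (seq z n) ε))
    (p ε 0<ε)
    where open +-*-Solver

  ⊕-⊖ : ∀ x y → (x ⊕ y) ⊖ x ≃ y
  ⊕-⊖ x y = pointwise λ n → solve 2 (λ x y → (x :+ y) :- x := y) refl (seq x n) (seq y n)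
    where open +-*-Solver

  ⊕-⊖-cancel : ∀ x y → x ⊕ (y ⊖ x) ≃ y
  ⊕-⊖-cancel x y = pointwise λ n → solve 2 (λ x y → x :+ (y :- x) := y) refl (seq x n) (seq y n)
    where open +-*-Solver

  ∣s-l∣≺ε⇒l≺s⊕ε : ∀ s l {ε} → ∣ s - l ∣ ≺ ε → l ≺ s ⊕ ε
  ∣s-l∣≺ε⇒l≺s⊕ε s l {ε} (mk≺ (δ , 0<δ , p)) = mk≺ (½ ℚ.* δ , ½-pos 0<δ , eventually₁
    (λ n a → shift-< (seq l n ℚ.+ ½ ℚ.* δ) (seq s n ℚ.+ seq ε n) (ℚ.∣ seq l n ℚ.- seq s n ∣ ℚ.+ ½ ℚ.* δ)
      (ℚ.+-mono-<
        (∣-∣<⇒<+ (seq l n) (seq s n) (grow ℚ.∣ seq l n ℚ.- seq s n ∣))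
        (subst (λ t → t ℚ.+ δ ℚ.< seq ε n) (∣-∣-comm (seq s n) (seq l n)) a))
      (solve 3 (λ l d a → (l :+ con ½ :* d) :+ (a :+ con ½ :* d) := l :+ (a :+ d))
        refl (seq l n) δ ℚ.∣ seq l n ℚ.- seq s n ∣)
      (solve 4 (λ s e d a → (s :+ e) :+ (a :+ con ½ :* d) := (s :+ (a :+ con ½ :* d)) :+ e)
        refl (seq s n) (seq ε n) δ ℚ.∣ seq l n ℚ.- seq s n ∣))
    p)
    where
    open +-*-Solver
    grow : ∀ a → a ℚ.< a ℚ.+ ½ ℚ.* δ
    grow a = subst (ℚ._< a ℚ.+ ½ ℚ.* δ) (ℚ.+-identityʳ a) (ℚ.+-monoʳ-< a (½-pos 0<δ))

  ≼-from-rational : ∀ {x y} → (∀ q → 0ℚ ℚ.< q → x ≼ y ⊕ fromℚ q) → x ≼ y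
  ≼-from-rational {x} {y} h = mk≼ λ ε 0<ε → eventually₁
    (λ n → subst (seq x n ℚ.<_)
      (solve 2 (λ e y → (y :+ con ½ :* e) :+ con ½ :* e := y :+ e) refl ε (seq y n)))
    (within (h (½ ℚ.* ε) (½-pos 0<ε)) (½ ℚ.* ε) (½-pos 0<ε))
    where open +-*-Solver

  fromℚ-halves : ∀ q → fromℚ (½ ℚ.* q) ⊕ fromℚ (½ ℚ.* q) ≃ fromℚ q
  fromℚ-halves q = pointwise λ _ → solve 1 (λ q → con ½ :* q :+ con ½ :* q := q) refl q
    where open +-*-Solver

fromℚ-pos : ∀ {q} → 0ℚ ℚ.< q → 0ℝ ≺ fromℚ q
fromℚ-pos {q} 0<q = mk≺ (½ ℚ.* q , ½-pos 0<q , 0 , λ _ _ →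
  shift-< (0ℚ ℚ.+ ½ ℚ.* q) q 0ℚ (ℚ.+-monoˡ-< (½ ℚ.* q) (½-pos 0<q))
    (ℚ.+-identityʳ _)
    (solve 1 (λ q → q :+ con 0ℚ := con ½ :* q :+ con ½ :* q) refl q))
  where open +-*-Solver

⊕-cong : ∀ {x y u v} → x ≃ y → u ≃ v → x ⊕ u ≃ y ⊕ v
⊕-cong (p , q) (p′ , q′) = ⊕-mono-≼ p p′ , ⊕-mono-≼ q q′

⊕-cancelˡ : ∀ {x u y z} → x ≃ u → x ⊕ y ≃ u ⊕ z → y ≃ z
⊕-cancelˡ {x} {u} {y} {z} h (k , k′) = ≃-trans
  (≃-sym (⊕-⊖ x y))
  (≃-trans (⊖-mono-≼ (≃⇒≼ k″) , ⊖-mono-≼ (≃⇒≽ k″)) (⊕-⊖ x z))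
  where
  k″ : x ⊕ y ≃ x ⊕ z
  k″ = ≃-trans (k , k′) (⊕-cong (≃-sym h) ≃-refl)

x≼x⊕y : ∀ {x y} → 0ℝ ≼ y → x ≼ x ⊕ y
x≼x⊕y {x} 0≼y = ≼-trans (≃⇒≽ (⊕-identityʳ x)) (⊕-mono-≼ ≼-refl 0≼y)

∣-∣-cong : ∀ {x y} → x ≃ y → ∣ x ∣ ≃ ∣ y ∣
∣-∣-cong {x} {y} h = ≈⇒≃ _ _ λ ε 0<ε →
  eventually₁ (λ n → ℚ.≤-<-trans (∣∣-∣∣≤ (seq x n) (seq y n))) (≃⇒≈ h ε 0<ε)
  where
  open +-*-Solver
  half : ∀ a b → ℚ.∣ a ∣ ℚ.- ℚ.∣ b ∣ ℚ.≤ ℚ.∣ a ℚ.- b ∣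
  half a b = subst₂ ℚ._≤_
    (cong (λ t → ℚ.∣ t ∣ ℚ.- ℚ.∣ b ∣) (solve 2 (λ a b → (a :- b) :+ b := a) refl a b))
    (solve 2 (λ a b → (a :+ b) :- b := a) refl ℚ.∣ a ℚ.- b ∣ ℚ.∣ b ∣)
    (ℚ.+-monoˡ-≤ (ℚ.- ℚ.∣ b ∣) (ℚ.∣p+q∣≤∣p∣+∣q∣ (a ℚ.- b) b))
  ∣∣-∣∣≤ : ∀ a b → ℚ.∣ ℚ.∣ a ∣ ℚ.- ℚ.∣ b ∣ ∣ ℚ.≤ ℚ.∣ a ℚ.- b ∣
  ∣∣-∣∣≤ a b with ℚ.∣p∣≡p∨∣p∣≡-p (ℚ.∣ a ∣ ℚ.- ℚ.∣ b ∣)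
  ... | inj₁ e = subst (ℚ._≤ ℚ.∣ a ℚ.- b ∣) (sym e) (half a b)
  ... | inj₂ e = subst₂ ℚ._≤_
    (trans (solve 2 (λ a b → b :- a := :- (a :- b)) refl ℚ.∣ a ∣ ℚ.∣ b ∣) (sym e))
    (∣-∣-comm b a) (half b a)

-- The terms of a nonnegative real may be negative, but eventually they exceed `- ½ ε`; for a
-- negative term `a` the error is `-2a`, hence below `ε`.
0≼x⇒∣x∣≃x : ∀ {x} → 0ℝ ≼ x → ∣ x ∣ ≃ x
0≼x⇒∣x∣≃x {x} (mk≼ 0≼x) = ≈⇒≃ _ _ λ ε 0<ε →
  eventually₁ (λ n → close ε 0<ε (seq x n)) (0≼x (½ ℚ.* ε) (½-pos 0<ε))
  where
  open +-*-Solver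
  close : ∀ ε → 0ℚ ℚ.< ε → ∀ a → 0ℚ ℚ.< a ℚ.+ ½ ℚ.* ε → ℚ.∣ ℚ.∣ a ∣ ℚ.- a ∣ ℚ.< ε
  close ε 0<ε a h with ℚ.≤-total 0ℚ a
  ... | inj₁ 0≤a = subst (ℚ._< ε)
        (sym (trans (cong (λ t → ℚ.∣ t ℚ.- a ∣) (ℚ.0≤p⇒∣p∣≡p 0≤a)) (cong ℚ.∣_∣ (ℚ.+-inverseʳ a)))) 0<ε
  ... | inj₂ a≤0 = <+⇒∣-∣< ℚ.∣ a ∣ a
        (subst (ℚ._< a ℚ.+ ε) (sym ∣a∣≡-a) (shift-< (ℚ.- a) (a ℚ.+ ε) a
          (ℚ.+-mono-< h h) (ℚ.+-inverseˡ a)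
          (solve 2 (λ a e → a :+ e :+ a := (a :+ con ½ :* e) :+ (a :+ con ½ :* e)) refl a ε)))
        (ℚ.≤-<-trans a≤0 (ℚ.+-mono-≤-< (ℚ.0≤∣p∣ a) 0<ε))
    where
    ∣a∣≡-a : ℚ.∣ a ∣ ≡ ℚ.- a
    ∣a∣≡-a = trans (sym (ℚ.∣-p∣≡∣p∣ a)) (ℚ.0≤p⇒∣p∣≡p (ℚ.neg-antimono-≤ a≤0))

data Comparison (x y : ℝ) : Set where
  less    : x ≺ y → Comparison x y
  equal   : x ≃ y → Comparison x y
  greater : y ≺ x → Comparison x y

compare : ExcludedMiddle 0ℓ → ∀ x y → Comparison x y
compare em x y with em {x < y} | em {y < x}
... | yes x<y | _       = less (mk≺ x<y)
... | no _    | yes y<x = greater (mk≺ y<x)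
... | no x≮y  | no y≮x  = equal (≤⇒≼ x y y≮x , ≤⇒≼ y x x≮y)

∣x-y∣-comm : ∀ x y → ∣ x - y ∣ ≃ ∣ y - x ∣
∣x-y∣-comm x y = pointwise λ n → ∣-∣-comm (seq x n) (seq y n)

≈-refl : ∀ x → x ≈ x
≈-refl x = ≃⇒≈ (≃-refl {x})

sum-three : (v : Fin 3 → ℝ) → sum v ≃ (v zero ⊕ v (suc zero)) ⊕ v (suc (suc zero))
sum-three v = ≃-trans (sum-suc v) (≃-trans
  (⊕-cong ≃-refl (≃-trans (sum-suc (λ i → v (suc i))) (⊕-cong ≃-refl
    (≃-trans (sum-suc (λ i → v (suc (suc i)))) (≃-trans
      (⊕-cong ≃-refl (sum-zero (λ i → v (suc (suc (suc i)))))) (⊕-identityʳ _))))))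
  (≃-sym (⊕-assoc (v zero) (v (suc zero)) (v (suc (suc zero))))))

-- Boolean operations on Borel sets and finite additivity

module Sets (em : ExcludedMiddle 0ℓ) where

  stable : ∀ {P : Set} → ¬ ¬ P → P
  stable {P} ¬¬p with em {P}
  ... | yes p = p
  ... | no ¬p = ⊥-elim (¬¬p ¬p)

  ⟦_⟧ : BorelSet → Subset
  ⟦_⟧ = BorelSet.set

  ∁ᴮ : BorelSet → BorelSet
  ∁ᴮ A = record { set = ∁ ⟦ A ⟧ ; isBorel = complement (BorelSet.isBorel A) }

  infixr 6 _∪ᴮ_
  infixr 7 _∩ᴮ_

  _∪ᴮ_ : BorelSet → BorelSet → BorelSet
  A ∪ᴮ B = record
    { set     = ⟦ A ⟧ ∪ ⟦ B ⟧
    ; isBorel = respects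
        ((λ { (zero , x∈A) → inj₁ x∈A ; (suc _ , x∈B) → inj₂ x∈B }) ,
         (λ { (inj₁ x∈A) → 0 , x∈A ; (inj₂ x∈B) → 1 , x∈B }))
        (union λ n → BorelSet.isBorel (pick n))
    }
    where
    pick : ℕ → BorelSet
    pick zero    = A
    pick (suc _) = B

  _∩ᴮ_ : BorelSet → BorelSet → BorelSet
  A ∩ᴮ B = record
    { set     = ⟦ A ⟧ ∩ ⟦ B ⟧
    ; isBorel = respects
        ((λ x∉ → stable (λ x∉A → x∉ (inj₁ x∉A)) , stable (λ x∉B → x∉ (inj₂ x∉B))) ,
         (λ { (x∈A , _) (inj₁ x∉A) → x∉A x∈A ; (_ , x∈B) (inj₂ x∉B) → x∉B x∈B }))
        (BorelSet.isBorel (∁ᴮ (∁ᴮ A ∪ᴮ ∁ᴮ B)))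
    }

  initial : (ℕ → BorelSet) → ℕ → BorelSet
  initial A zero    = ∅ᴮ
  initial A (suc n) = A 0 ∪ᴮ initial (A ∘ suc) n

  ∈-initial⁺ : ∀ A {n k x} → k ℕ.< n → x ∈ ⟦ A k ⟧ → x ∈ ⟦ initial A n ⟧
  ∈-initial⁺ A {suc n} {zero}  _         x∈ = inj₁ x∈
  ∈-initial⁺ A {suc n} {suc k} (s≤s k<n) x∈ = inj₂ (∈-initial⁺ (A ∘ suc) k<n x∈)

  ∈-initial⁻ : ∀ A {n x} → x ∈ ⟦ initial A n ⟧ → ∃[ k ] k ℕ.< n × x ∈ ⟦ A k ⟧
  ∈-initial⁻ A {suc n} (inj₁ x∈) = 0 , s≤s z≤n , x∈
  ∈-initial⁻ A {suc n} (inj₂ x∈) with ∈-initial⁻ (A ∘ suc) x∈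
  ... | k , k<n , x∈A = suc k , s≤s k<n , x∈A

  initial-mono : ∀ A {m n} → m ℕ.≤ n → ⟦ initial A m ⟧ ⊆ ⟦ initial A n ⟧
  initial-mono A {m} m≤n x∈ =
    let k , k<m , x∈A = ∈-initial⁻ A {m} x∈ in ∈-initial⁺ A (ℕ.≤-trans k<m m≤n) x∈A

  -- The usual disjointification, which makes countable additivity applicable to arbitrary sequences
  -- without changing finite or countable unions.
  fresh : (ℕ → BorelSet) → ℕ → BorelSet
  fresh A n = A n ∩ᴮ ∁ᴮ (initial A n)

  fresh-disjoint : ∀ A {m n} → m ≢ n → ⟦ fresh A m ⟧ ⊥ ⟦ fresh A n ⟧
  fresh-disjoint A {m} {n} m≢n ((x∈Am , x∉m) , (x∈An , x∉n)) with ℕ.<-cmp m n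
  ... | tri< m<n _ _ = x∉n (∈-initial⁺ A m<n x∈Am)
  ... | tri≈ _ m≡n _ = m≢n m≡n
  ... | tri> _ _ n<m = x∉m (∈-initial⁺ A n<m x∈An)

  -- The least index is found by induction on the bound: excluded middle tells whether an index
  -- below `n` already works, and if none does, the given index must be `n` and is minimal.
  first-hit : ∀ A {x} n → ∃[ k ] k ℕ.< n × x ∈ ⟦ A k ⟧ → ∃[ k ] k ℕ.< n × x ∈ ⟦ fresh A k ⟧
  first-hit A {x} (suc n) (k , s≤s k≤n , x∈) with em {∃[ k ] k ℕ.< n × x ∈ ⟦ A k ⟧}
  ... | yes earlier = let j , j<n , x∈D = first-hit A n earlier in j , ℕ.m<n⇒m<1+n j<n , x∈D
  ... | no ¬earlier with ℕ.m≤n⇒m<n∨m≡n k≤n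
  ...   | inj₁ k<n  = ⊥-elim (¬earlier (k , k<n , x∈))
  ...   | inj₂ refl = n , ℕ.≤-refl , x∈ , (¬earlier ∘ ∈-initial⁻ A)

  initial-fresh : ∀ A n → ⟦ initial (fresh A) n ⟧ ≐ ⟦ initial A n ⟧
  initial-fresh A n =
    (λ x∈ → let k , k<n , x∈A , _ = ∈-initial⁻ (fresh A) {n} x∈ in ∈-initial⁺ A k<n x∈A) ,
    (λ x∈ → let k , k<n , x∈D = first-hit A n (∈-initial⁻ A x∈) in ∈-initial⁺ (fresh A) k<n x∈D)

  ⋃-fresh : ∀ A → ⟦ ⋃ᴮ (fresh A) ⟧ ≐ ⟦ ⋃ᴮ A ⟧
  ⋃-fresh A =
    (λ { (k , x∈A , _) → k , x∈A }) ,
    (λ { (k , x∈A) → let j , _ , x∈D = first-hit A (suc k) (k , ℕ.≤-refl , x∈A) in j , x∈D })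

  -- At a late index the sequence is both equal to `c` and within any rational of `l`. This is what
  -- extracts finite additivity from countable additivity.
  ⟶-unique : ∀ {s : ℕ → ℝ} {l c} → s ⟶ l → ∀ N → (∀ n → N ℕ.≤ n → s n ≃ c) → l ≃ c
  ⟶-unique {s} {l} {c} s⟶l N s≃c =
    ≼-from-rational (λ q 0<q → let n , close , e = late q 0<q in
      ≼-trans (≺⇒≼ (∣s-l∣≺ε⇒l≺s⊕ε (s n) l close)) (≃⇒≼ (⊕-cong e ≃-refl))) ,
    ≼-from-rational (λ q 0<q → let n , close , e = late q 0<q in
      ≼-trans (≃⇒≽ e) (≺⇒≼ (∣s-l∣≺ε⇒l≺s⊕ε l (s n) (≼-≺-trans (≃⇒≼ (∣x-y∣-comm l (s n))) close))))
    where
    late : ∀ q → 0ℚ ℚ.< q → ∃[ n ] (∣ s n - l ∣ ≺ fromℚ q) × s n ≃ c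
    late q 0<q = let M , p = s⟶l (fromℚ q) (unwrap (fromℚ-pos 0<q)) in
      M ℕ.⊔ N , mk≺ (p _ (ℕ.m≤m⊔n M N)) , s≃c _ (ℕ.m≤n⊔m M N)

  module Measure (μ : ProbabilityMeasure) where

    meas : BorelSet → ℝ
    meas = measure μ

    meas-cong : ∀ {A B} → ⟦ A ⟧ ≐ ⟦ B ⟧ → meas A ≃ meas B
    meas-cong {A} {B} e = ≈⇒≃ _ _ (measure-cong μ {A} {B} e)

    meas-∅ : ∀ {A} → (∀ x → x ∉ ⟦ A ⟧) → meas A ≃ 0ℝ
    meas-∅ {A} empty = ≃-trans (meas-cong ((λ {x} → empty x) , λ ())) (≈⇒≃ _ _ (measure-∅ μ))

    meas-nonneg : ∀ A → 0ℝ ≼ meas A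
    meas-nonneg A = ≤⇒≼ _ _ (nonnegative μ A)

    private
      two : BorelSet → BorelSet → ℕ → BorelSet
      two A B 0             = A
      two A B 1             = B
      two A B (suc (suc _)) = ∅ᴮ

      two-disjoint : ∀ {A B} → ⟦ A ⟧ ⊥ ⟦ B ⟧ → ∀ {m n} → m ≢ n → ⟦ two A B m ⟧ ⊥ ⟦ two A B n ⟧
      two-disjoint A⊥B {0}           {0}           m≢n _         = m≢n refl
      two-disjoint A⊥B {0}           {1}           _   (a , b)   = A⊥B (a , b)
      two-disjoint A⊥B {1}           {0}           _   (b , a)   = A⊥B (a , b)
      two-disjoint A⊥B {1}           {1}           m≢n _         = m≢n refl
      two-disjoint A⊥B {0}           {suc (suc _)} _   (_ , ())
      two-disjoint A⊥B {1}           {suc (suc _)} _   (_ , ())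
      two-disjoint A⊥B {suc (suc _)} {_}           _   (() , _)

      sum-∅ : ∀ n → sum {n} (λ _ → meas ∅ᴮ) ≃ 0ℝ
      sum-∅ zero    = sum-zero _
      sum-∅ (suc n) = ≃-trans (sum-suc {n} (λ _ → meas ∅ᴮ))
        (≃-trans (⊕-cong (meas-∅ {∅ᴮ} (λ _ ())) (sum-∅ n)) (⊕-identityʳ 0ℝ))

      sum-two : ∀ A B n → 2 ℕ.≤ n → sum {n} (λ i → meas (two A B (toℕ i))) ≃ meas A ⊕ meas B
      sum-two A B (suc (suc n)) _ = ≃-trans (sum-suc (λ i → meas (two A B (toℕ i)))) (⊕-cong ≃-refl
        (≃-trans (sum-suc (λ i → meas (two A B (toℕ (suc i)))))
          (≃-trans (⊕-cong ≃-refl (sum-∅ n)) (⊕-identityʳ (meas B)))))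
      sum-two A B 1 (s≤s ())

    -- Countable additivity is applied to the sequence `A`, `B`, `∅`, `∅`, ..., whose partial sums
    -- are constant from the second on.
    meas-∪ : ∀ A B → ⟦ A ⟧ ⊥ ⟦ B ⟧ → meas (A ∪ᴮ B) ≃ meas A ⊕ meas B
    meas-∪ A B A⊥B = ≃-trans
      (meas-cong {A ∪ᴮ B} {⋃ᴮ (two A B)}
        ((λ { (inj₁ a) → 0 , a ; (inj₂ b) → 1 , b }) ,
         (λ { (0 , a) → inj₁ a ; (1 , b) → inj₂ b })))
      (⟶-unique (countablyAdditive μ (two A B) (two-disjoint {A} {B} A⊥B)) 2
        (λ n 2≤n → ≃-trans (≃-sym (sum≃∑ {n} (λ i → meas (two A B (toℕ i))))) (sum-two A B n 2≤n)))

    meas-split : ∀ A B → meas A ≃ meas (A ∩ᴮ B) ⊕ meas (A ∩ᴮ ∁ᴮ B)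
    meas-split A B = ≃-trans
      (meas-cong {A} {(A ∩ᴮ B) ∪ᴮ (A ∩ᴮ ∁ᴮ B)}
        ((λ {x} a → by-cases a (em {x ∈ ⟦ B ⟧})) ,
         (λ { (inj₁ (a , _)) → a ; (inj₂ (a , _)) → a })))
      (meas-∪ (A ∩ᴮ B) (A ∩ᴮ ∁ᴮ B) (λ { ((_ , b) , (_ , ¬b)) → ¬b b }))
      where
      by-cases : ∀ {x} → x ∈ ⟦ A ⟧ → Dec (x ∈ ⟦ B ⟧) → x ∈ ⟦ (A ∩ᴮ B) ∪ᴮ (A ∩ᴮ ∁ᴮ B) ⟧
      by-cases a (yes b) = inj₁ (a , b)
      by-cases a (no ¬b) = inj₂ (a , ¬b)

    meas-diff : ∀ {A B} → ⟦ B ⟧ ⊆ ⟦ A ⟧ → meas A ≃ meas B ⊕ meas (A ∩ᴮ ∁ᴮ B)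
    meas-diff {A} {B} B⊆A = ≃-trans (meas-split A B)
      (⊕-cong (meas-cong (proj₂ , (λ b → B⊆A b , b))) ≃-refl)

    meas-mono : ∀ {A B} → ⟦ A ⟧ ⊆ ⟦ B ⟧ → meas A ≼ meas B
    meas-mono {A} {B} A⊆B = ≼-trans (x≼x⊕y (meas-nonneg (B ∩ᴮ ∁ᴮ A))) (≃⇒≽ (meas-diff {B} {A} A⊆B))

    meas-subadditive : ∀ A B → meas (A ∪ᴮ B) ≼ meas A ⊕ meas B
    meas-subadditive A B = ≼-trans
      (≃⇒≼ (meas-diff {A ∪ᴮ B} {A} inj₁))
      (⊕-mono-≼ ≼-refl (meas-mono {(A ∪ᴮ B) ∩ᴮ ∁ᴮ A} {B}
        (λ { (inj₁ a , ¬a) → ⊥-elim (¬a a) ; (inj₂ b , _) → b })))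

    sum-initial : ∀ A → (∀ {m n} → m ≢ n → ⟦ A m ⟧ ⊥ ⟦ A n ⟧) →
      ∀ n → sum {n} (λ i → meas (A (toℕ i))) ≃ meas (initial A n)
    sum-initial A disj zero    = ≃-trans (sum-zero (λ i → meas (A (toℕ i)))) (≃-sym (meas-∅ {∅ᴮ} (λ _ ())))
    sum-initial A disj (suc n) = ≃-trans (sum-suc (λ i → meas (A (toℕ i)))) (≃-trans
      (⊕-cong ≃-refl (sum-initial (A ∘ suc) (λ m≢n → disj (m≢n ∘ ℕ.suc-injective)) n))
      (≃-sym (meas-∪ (A 0) (initial (A ∘ suc) n)
        (λ { (x∈A0 , x∈) → let k , _ , x∈Ak = ∈-initial⁻ (A ∘ suc) {n} x∈ in
               disj {0} {suc k} (λ ()) (x∈A0 , x∈Ak) }))))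

    -- After disjointification the partial sums are the measures of the finite unions and converge
    -- to that of the whole union. Choosing `N` with error below `q` and cancelling the measure of
    -- the finite union bounds the remainder.
    meas-tail : ∀ A q → 0ℚ ℚ.< q → ∃[ N ] meas (⋃ᴮ A ∩ᴮ ∁ᴮ (initial A N)) ≼ fromℚ q
    meas-tail A q 0<q = N , ≼-trans
      (≃⇒≽ (⊕-⊖ (meas I) tail))
      (≼-trans (⊖-mono-≼ {z = meas I} (≼-trans (≃⇒≽ whole) (≺⇒≼ nearly)))
        (≃⇒≼ (⊕-⊖ (meas I) (fromℚ q))))
      where
      D = fresh A
      limit : Σ[ N ∈ ℕ ] (∀ n → N ℕ.≤ n → ∣ ∑ {n} (λ i → meas (D (toℕ i))) - meas (⋃ᴮ D) ∣ < fromℚ q)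
      limit = countablyAdditive μ D (fresh-disjoint A) (fromℚ q) (unwrap (fromℚ-pos 0<q))
      N = proj₁ limit
      I = initial A N
      tail = meas (⋃ᴮ A ∩ᴮ ∁ᴮ I)
      whole : meas (⋃ᴮ A) ≃ meas I ⊕ tail
      whole = meas-diff {⋃ᴮ A} {I} (λ x∈ → let k , _ , x∈Ak = ∈-initial⁻ A {N} x∈ in k , x∈Ak)
      nearly : meas (⋃ᴮ A) ≺ meas I ⊕ fromℚ q
      nearly = ≼-≺-trans (≃⇒≽ (meas-cong {⋃ᴮ D} {⋃ᴮ A} (⋃-fresh A)))
        (≺-≼-trans (∣s-l∣≺ε⇒l≺s⊕ε _ _ (mk≺ (proj₂ limit N ℕ.≤-refl)))
          (⊕-mono-≼ (≃⇒≼ partial-sum) ≼-refl))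
        where
        partial-sum : ∑ {N} (λ i → meas (D (toℕ i))) ≃ meas I
        partial-sum = ≃-trans (≃-sym (sum≃∑ (λ i → meas (D (toℕ i)))))
          (≃-trans (sum-initial D (fresh-disjoint A) N)
            (meas-cong {initial D N} {I} (initial-fresh A N)))

-- Two measures that agree on the sets of finite level agree on all Borel sets

Agree-sym : ∀ {n x y} → Agree n x y → Agree n y x
Agree-sym x~y i i<n = sym (x~y i i<n)

Agree-mono : ∀ {m n x y} → m ℕ.≤ n → Agree n x y → Agree m x y
Agree-mono m≤n x~y i i<m = x~y i (ℕ.<-≤-trans i<m m≤n)

-- A `Clopen` only supplies an agreement length at each point, and a common one would call for
-- compactness; here the number of relevant bits is carried along as data.
record LevelSet : Set₁ where
  field
    set       : Subset
    level     : ℕ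
    invariant : ∀ {x y} → Agree level x y → x ∈ set → y ∈ set

  borel : BorelSet
  borel = record { set = set ; isBorel = open-set λ x x∈ → level , λ y x~y → invariant x~y x∈ }

∁ᴸ : LevelSet → LevelSet
∁ᴸ K = record
  { set = ∁ (set K) ; level = level K ; invariant = λ x~y x∉ y∈ → x∉ (invariant K (Agree-sym x~y) y∈) }
  where open LevelSet

_∪ᴸ_ : LevelSet → LevelSet → LevelSet
K ∪ᴸ L = record
  { set       = set K ∪ set L
  ; level     = level K ℕ.⊔ level L
  ; invariant = λ x~y → λ
      { (inj₁ x∈) → inj₁ (invariant K (Agree-mono (ℕ.m≤m⊔n _ _) x~y) x∈)
      ; (inj₂ x∈) → inj₂ (invariant L (Agree-mono (ℕ.m≤n⊔m (level K) (level L)) x~y) x∈) }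
  }
  where open LevelSet

∅ᴸ : LevelSet
∅ᴸ = record { set = ∅ ; level = 0 ; invariant = λ _ () }

module Uniqueness (em : ExcludedMiddle 0ℓ) (μ ν : ProbabilityMeasure) where

  open Sets em
  private
    module M = Measure μ
    module N = Measure ν

  record Small (q : ℚ) (E : BorelSet) : Set where
    constructor _,_
    field
      μ-small : measure μ E ≼ fromℚ q
      ν-small : measure ν E ≼ fromℚ q
  open Small

  Small-∪ : ∀ {q} E F → Small (½ ℚ.* q) E → Small (½ ℚ.* q) F → Small q (E ∪ᴮ F)
  Small-∪ {q} E F (a , b) (c , d) =
    ≼-trans (M.meas-subadditive E F) (≼-trans (⊕-mono-≼ a c) (≃⇒≼ (fromℚ-halves q))) ,
    ≼-trans (N.meas-subadditive E F) (≼-trans (⊕-mono-≼ b d) (≃⇒≼ (fromℚ-halves q)))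

  Small-∅ : ∀ {q} → 0ℚ ℚ.< q → Small q ∅ᴮ
  Small-∅ 0<q =
    ≼-trans (≃⇒≼ (M.meas-∅ {∅ᴮ} (λ _ ()))) (≺⇒≼ (fromℚ-pos 0<q)) ,
    ≼-trans (≃⇒≼ (N.meas-∅ {∅ᴮ} (λ _ ()))) (≺⇒≼ (fromℚ-pos 0<q))

  -- The symmetric difference of `A` and `near` is enclosed in a Borel set that is small for both
  -- measures at once, so one level set can compare them. Stated as two implications outside
  -- `error`, the notion passes to complements with the same error set.
  record Approximation (A : Subset) (q : ℚ) : Set₁ where
    field
      near     : LevelSet
      error    : BorelSet
      small    : Small q error
      inside   : ∀ {x} → x ∉ ⟦ error ⟧ → x ∈ A → x ∈ LevelSet.set near
      converse : ∀ {x} → x ∉ ⟦ error ⟧ → x ∈ LevelSet.set near → x ∈ A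
  open Approximation

  Approximable : Subset → Set₁
  Approximable A = ∀ q → 0ℚ ℚ.< q → Approximation A q

  approx-∁ : ∀ {A} → Approximable A → Approximable (∁ A)
  approx-∁ h q 0<q = let a = h q 0<q in record
    { near = ∁ᴸ (near a) ; error = error a ; small = small a
    ; inside   = λ x∉E x∉A x∈K → x∉A (converse a x∉E x∈K)
    ; converse = λ x∉E x∉K x∈A → x∉K (inside a x∉E x∈A) }

  approx-∪ : ∀ {A B} → Approximable A → Approximable B → Approximable (A ∪ B)
  approx-∪ h k q 0<q =
    let a = h (½ ℚ.* q) (½-pos 0<q) ; b = k (½ ℚ.* q) (½-pos 0<q) in record
    { near  = near a ∪ᴸ near b
    ; error = error a ∪ᴮ error b
    ; small = Small-∪ (error a) (error b) (small a) (small b)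
    ; inside = λ x∉E → λ { (inj₁ x∈A) → inj₁ (inside a (x∉E ∘ inj₁) x∈A)
                         ; (inj₂ x∈B) → inj₂ (inside b (x∉E ∘ inj₂) x∈B) }
    ; converse = λ x∉E → λ { (inj₁ x∈K) → inj₁ (converse a (x∉E ∘ inj₁) x∈K)
                           ; (inj₂ x∈K) → inj₂ (converse b (x∉E ∘ inj₂) x∈K) } }

  approx-level : ∀ K → Approximable (LevelSet.set K)
  approx-level K q 0<q = record
    { near = K ; error = ∅ᴮ ; small = Small-∅ 0<q ; inside = λ _ x∈ → x∈ ; converse = λ _ x∈ → x∈ }

  approx-≐ : ∀ {A B} → A ≐ B → Approximable A → Approximable B
  approx-≐ (A⊆B , B⊆A) h q 0<q = let a = h q 0<q in record
    { near = near a ; error = error a ; small = small a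
    ; inside = λ x∉E x∈B → inside a x∉E (B⊆A x∈B) ; converse = λ x∉E x∈K → A⊆B (converse a x∉E x∈K) }

  approx-initial : ∀ A → (∀ n → Approximable ⟦ A n ⟧) → ∀ n → Approximable ⟦ initial A n ⟧
  approx-initial A h zero    = approx-level ∅ᴸ
  approx-initial A h (suc n) = approx-∪ (h 0) (approx-initial (A ∘ suc) (h ∘ suc) n)

  -- The union is truncated at the larger of the two indices beyond which the tail is small for `μ`
  -- and for `ν`. Half of `q` pays for the rest `T`, which lies in both tails, and half for
  -- approximating the finite union.
  approx-⋃ : ∀ A → (∀ n → Approximable ⟦ A n ⟧) → Approximable ⟦ ⋃ᴮ A ⟧
  approx-⋃ A h q 0<q =
    combine (M.meas-tail A (½ ℚ.* q) (½-pos 0<q)) (N.meas-tail A (½ ℚ.* q) (½-pos 0<q))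
    where
    combine : ∃[ m ] measure μ (⋃ᴮ A ∩ᴮ ∁ᴮ (initial A m)) ≼ fromℚ (½ ℚ.* q) →
              ∃[ n ] measure ν (⋃ᴮ A ∩ᴮ ∁ᴮ (initial A n)) ≼ fromℚ (½ ℚ.* q) →
              Approximation ⟦ ⋃ᴮ A ⟧ q
    combine (m , μ-tail) (n , ν-tail) = record
      { near  = near a
      ; error = error a ∪ᴮ T
      ; small = Small-∪ (error a) T (small a)
          ( ≼-trans (M.meas-mono {T} {⋃ᴮ A ∩ᴮ ∁ᴮ (initial A m)} (λ { (x , y , _) → x , y })) μ-tail
          , ≼-trans (N.meas-mono {T} {⋃ᴮ A ∩ᴮ ∁ᴮ (initial A n)} (λ { (x , _ , y) → x , y })) ν-tail )
      ; inside   = λ {x} x∉E x∈⋃ → inside a (x∉E ∘ inj₁) (stable λ x∉I →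
          x∉E (inj₂ (x∈⋃ , x∉I ∘ initial-mono A {m} (ℕ.m≤m⊔n m n) , x∉I ∘ initial-mono A {n} (ℕ.m≤n⊔m m n))))
      ; converse = λ x∉E x∈K →
          let k , _ , x∈A = ∈-initial⁻ A {m ℕ.⊔ n} (converse a (x∉E ∘ inj₁) x∈K) in k , x∈A
      }
      where
      a = approx-initial A h (m ℕ.⊔ n) (½ ℚ.* q) (½-pos 0<q)
      T = ⋃ᴮ A ∩ᴮ ∁ᴮ (initial A m) ∩ᴮ ∁ᴮ (initial A n)

  -- An open set is the union over `n` of the points whose whole cylinder of length `n` lies in it,
  -- and each such stage depends on `n` bits only.
  approx-open : ∀ {A} → IsOpen A → Approximable A
  approx-open {A} o = approx-≐
    ((λ { {x} (n , f) → f x (λ _ _ → refl) }) , (λ {x} → o x))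
    (approx-⋃ (LevelSet.borel ∘ stage) (approx-level ∘ stage))
    where
    stage : ℕ → LevelSet
    stage n = record
      { set       = λ x → ∀ y → Agree n x y → y ∈ A
      ; level     = n
      ; invariant = λ x~y f z y~z → f z (λ i i<n → trans (x~y i i<n) (y~z i i<n)) }

  approx-borel : ∀ {A} → IsBorel A → Approximable A
  approx-borel (open-set o)         = approx-open o
  approx-borel (complement b)       = approx-∁ (approx-borel b)
  approx-borel (union {A} b)        =
    approx-⋃ (λ n → record { set = A n ; isBorel = b n }) (λ n → approx-borel (b n))
  approx-borel (respects A≐B b)     = approx-≐ A≐B (approx-borel b)

  module _ (agree : ∀ K → measure μ (LevelSet.borel K) ≃ measure ν (LevelSet.borel K)) where

    measures-agree : ∀ A → measure μ A ≃ measure ν A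
    measures-agree A =
      dominated μ ν μ-small ν-small (λ K → ≃⇒≼ (agree K)) ,
      dominated ν μ ν-small μ-small (λ K → ≃⇒≽ (agree K))
      where
      dominated : ∀ ρ σ →
        (∀ {q E} → Small q E → measure ρ E ≼ fromℚ q) →
        (∀ {q E} → Small q E → measure σ E ≼ fromℚ q) →
        (∀ K → measure ρ (LevelSet.borel K) ≼ measure σ (LevelSet.borel K)) →
        measure ρ A ≼ measure σ A
      dominated ρ σ ρ-small σ-small ρ≼σ = ≼-from-rational bound
        where
        bound : ∀ q → 0ℚ ℚ.< q → measure ρ A ≼ measure σ A ⊕ fromℚ q
        bound q 0<q = begin
          measure ρ A                                         ∼⟨ Measure.meas-mono ρ {A} {K ∪ᴮ E} A⊆K∪E ⟩
          measure ρ (K ∪ᴮ E)                                  ∼⟨ Measure.meas-subadditive ρ K E ⟩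
          measure ρ K ⊕ measure ρ E                           ∼⟨ ⊕-mono-≼ (ρ≼σ (near a)) (ρ-small (small a)) ⟩
          measure σ K ⊕ fromℚ (½ ℚ.* q)                       ∼⟨ ⊕-mono-≼ (Measure.meas-mono σ {K} {A ∪ᴮ E} K⊆A∪E) ≼-refl ⟩
          measure σ (A ∪ᴮ E) ⊕ fromℚ (½ ℚ.* q)                ∼⟨ ⊕-mono-≼ (Measure.meas-subadditive σ A E) ≼-refl ⟩
          (measure σ A ⊕ measure σ E) ⊕ fromℚ (½ ℚ.* q)       ∼⟨ ⊕-mono-≼ (⊕-mono-≼ ≼-refl (σ-small (small a))) ≼-refl ⟩
          (measure σ A ⊕ fromℚ (½ ℚ.* q)) ⊕ fromℚ (½ ℚ.* q)   ≈⟨ ⊕-assoc _ _ _ ⟩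
          measure σ A ⊕ (fromℚ (½ ℚ.* q) ⊕ fromℚ (½ ℚ.* q))   ≈⟨ ⊕-cong ≃-refl (fromℚ-halves q) ⟩
          measure σ A ⊕ fromℚ q                               ∎
          where
          open ≼-Reasoning
          -- Half of `q` is taken because the error set is charged twice: under `ρ` when passing
          -- from `A` to `K`, and under `σ` on the way back.
          a = approx-borel (BorelSet.isBorel A) (½ ℚ.* q) (½-pos 0<q)
          K = LevelSet.borel (near a)
          E = error a
          A⊆K∪E : ⟦ A ⟧ ⊆ ⟦ K ∪ᴮ E ⟧
          A⊆K∪E {x} x∈A with em {x ∈ ⟦ E ⟧}
          ... | yes x∈E = inj₂ x∈E
          ... | no x∉E  = inj₁ (inside a x∉E x∈A)
          K⊆A∪E : ⟦ K ⟧ ⊆ ⟦ A ∪ᴮ E ⟧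
          K⊆A∪E {x} x∈K with em {x ∈ ⟦ E ⟧}
          ... | yes x∈E = inj₂ x∈E
          ... | no x∉E  = inj₁ (converse a x∉E x∈K)

-- Trees of clopen cells

clopen-≗ : ∀ V {x y} → x ≗ y → x ∈ Clopen.set V → y ∈ Clopen.set V
clopen-≗ V {x} {y} x≗y x∈ = proj₂ (Clopen.isOpen V x x∈) y (λ i _ → x≗y i)

data Node (I : Set) : Set where
  root : I → Node I
  _▹_  : Node I → Bool × Bool → Node I

depth : ∀ {I} → Node I → ℕ
depth (root _) = 0
depth (t ▹ _)  = suc (depth t)

▹-injective : ∀ {I} {s t : Node I} {c d} → s ▹ c ≡ t ▹ d → s ≡ t × c ≡ d
▹-injective refl = refl , refl

-- The cells of each depth partition the space, but some may be empty, so covering and uniqueness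
-- are stated through points. The left tree is used with `label = proj₁` and the right one with
-- `label = proj₂`, over the same nodes.
record Tree (I : Set) (label : Bool × Bool → Bool) : Set₁ where
  field
    cell          : Node I → Clopen
    root-of       : ∀ x → ∃[ i ] x ∈ Clopen.set (cell (root i))
    root-unique   : ∀ {x i j} → x ∈ Clopen.set (cell (root i)) → x ∈ Clopen.set (cell (root j)) → i ≡ j
    parent        : ∀ {x} t c → x ∈ Clopen.set (cell (t ▹ c)) → x ∈ Clopen.set (cell t)
    child         : ∀ {x} t → x ∈ Clopen.set (cell t) → ∃[ c ] x ∈ Clopen.set (cell (t ▹ c))
    child-unique  : ∀ {x} t c d → x ∈ Clopen.set (cell (t ▹ c)) → x ∈ Clopen.set (cell (t ▹ d)) → c ≡ d
    label-correct : ∀ {x} t c → x ∈ Clopen.set (cell (t ▹ c)) → x (depth t) ≡ label c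

  infix 4 _∈ᶜ_
  _∈ᶜ_ : 𝟚ᴺ → Node I → Set
  x ∈ᶜ t = x ∈ Clopen.set (cell t)

  node-unique : ∀ {x} s t → depth s ≡ depth t → x ∈ᶜ s → x ∈ᶜ t → s ≡ t
  node-unique (root i) (root j) _ x∈s x∈t = cong root (root-unique x∈s x∈t)
  node-unique (s ▹ c)  (t ▹ d)  e x∈s x∈t
    with refl ← node-unique s t (ℕ.suc-injective e) (parent s c x∈s) (parent t d x∈t)
    = cong (s ▹_) (child-unique s c d x∈s x∈t)

  walk  : 𝟚ᴺ → ℕ → Node I
  walk∈ : ∀ x n → x ∈ᶜ walk x n
  step  : 𝟚ᴺ → ℕ → Bool × Bool
  walk x zero     = root (proj₁ (root-of x))
  walk x (suc n)  = walk x n ▹ step x n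
  step x n        = proj₁ (child (walk x n) (walk∈ x n))
  walk∈ x zero    = proj₂ (root-of x)
  walk∈ x (suc n) = proj₂ (child (walk x n) (walk∈ x n))

  depth-walk : ∀ x n → depth (walk x n) ≡ n
  depth-walk x zero    = refl
  depth-walk x (suc n) = cong suc (depth-walk x n)

  step-correct : ∀ x n → x n ≡ label (step x n)
  step-correct x n = trans (cong x (sym (depth-walk x n)))
    (label-correct (walk x n) (step x n) (walk∈ x (suc n)))

  ∈⇒walk : ∀ {x} t → x ∈ᶜ t → walk x (depth t) ≡ t
  ∈⇒walk {x} t x∈t = node-unique (walk x (depth t)) t (depth-walk x (depth t)) (walk∈ x (depth t)) x∈t

  same-walk⇒same-step : ∀ {x y} n → walk x n ≡ walk y n → ∀ i → i ℕ.< n → step x i ≡ step y i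
  same-walk⇒same-step (suc n) e i i<n with ▹-injective e | ℕ.m<1+n⇒m<n∨m≡n i<n
  ... | e′ , _ | inj₁ i<n′ = same-walk⇒same-step n e′ i i<n′
  ... | _  , c | inj₂ refl = c

  -- The cell that `x` reaches at depth `n` is open, and lying in a cell determines the path down to
  -- it. Continuity of the maps between trees comes from here.
  walk-locally-constant : ∀ x n → ∃[ N ] ∀ y → Agree N x y → walk x n ≡ walk y n
  walk-locally-constant x n with Clopen.isOpen (cell (walk x n)) x (walk∈ x n)
  ... | N , p = N , λ y x~y → sym (trans
        (cong (walk y) (sym (depth-walk x n))) (∈⇒walk (walk x n) (p y x~y)))

open Tree

-- The continuous map between two trees over the same nodes

module Transfer (em : ExcludedMiddle 0ℓ) {I : Set} {ls lt : Bool × Bool → Bool}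
  (S : Tree I ls) (T : Tree I lt)
  (nonempty : ∀ t → Satisfiable (Clopen.set (cell S t)) → Satisfiable (Clopen.set (cell T t)))
  where

  open Sets em using (stable)

  -- This is the only candidate for a point lying in all `T`-cells along the `S`-path of `x`, since
  -- the cell after step `n` fixes bit `n`.
  transfer : 𝟚ᴺ → 𝟚ᴺ
  transfer x n = lt (step S x n)

  private
    descend : ∀ {z} x m n → m ℕ.≤ n → Clopen.set (cell T (walk S x n)) z → Clopen.set (cell T (walk S x m)) z
    descend x m zero    z≤n  z∈ = z∈
    descend x m (suc n) m≤1+n z∈ with ℕ.m≤n⇒m<n∨m≡n m≤1+n
    ... | inj₁ (s≤s m≤n) = descend x m n m≤n (parent T (walk S x n) (step S x n) z∈)
    ... | inj₂ refl      = z∈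

    cell⇒agree : ∀ {z} x n → Clopen.set (cell T (walk S x n)) z → Agree n (transfer x) z
    cell⇒agree {z} x n z∈ i i<n = sym (trans (cong z (sym (depth-walk S x i)))
      (label-correct T (walk S x i) (step S x i) (descend x (suc i) n i<n z∈)))

  -- If transfer x were outside the cell, so would be a neighbourhood of it;
  -- but deep cells along the walk are nonempty and lie in that neighbourhood.

  transfer∈ : ∀ x n → Clopen.set (cell T (walk S x n)) (transfer x)
  transfer∈ x n = stable λ x∉ →
    let N , p = Clopen.isClosed (cell T (walk S x n)) (transfer x) x∉
        z , z∈ = nonempty (walk S x (n ℕ.⊔ N)) (x , walk∈ S x (n ℕ.⊔ N))
    in p z (Agree-mono (ℕ.m≤n⊔m n N) (cell⇒agree x (n ℕ.⊔ N) z∈))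
         (descend x n (n ℕ.⊔ N) (ℕ.m≤m⊔n n N) z∈)

  walk-transfer : ∀ x n → walk T (transfer x) n ≡ walk S x n
  walk-transfer x n = trans (cong (walk T (transfer x)) (sym (depth-walk S x n)))
    (∈⇒walk T (walk S x n) (transfer∈ x n))

  transfer-step : ∀ x n → step T (transfer x) n ≡ step S x n
  transfer-step x n = proj₂ (▹-injective (walk-transfer x (suc n)))

  transfer-cell⁺ : ∀ t {x} → Clopen.set (cell S t) x → Clopen.set (cell T t) (transfer x)
  transfer-cell⁺ t {x} x∈ =
    subst (λ s → Clopen.set (cell T s) (transfer x)) (∈⇒walk S t x∈) (transfer∈ x (depth t))

  transfer-cell⁻ : ∀ t {x} → Clopen.set (cell T t) (transfer x) → Clopen.set (cell S t) x
  transfer-cell⁻ t {x} x∈ = subst (λ s → Clopen.set (cell S s) x)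
    (trans (sym (walk-transfer x (depth t))) (∈⇒walk T t x∈)) (walk∈ S x (depth t))

  transfer-locally-constant : ∀ x n → ∃[ N ] ∀ y → Agree N x y → Agree n (transfer x) (transfer y)
  transfer-locally-constant x n with walk-locally-constant S x n
  ... | N , p = N , λ y x~y i i<n → cong lt (same-walk⇒same-step S n (p y x~y) i i<n)

  transfer-continuous : Continuous transfer
  transfer-continuous A-open x x∈ =
    let n , p = A-open (transfer x) x∈
        N , q = transfer-locally-constant x n
    in N , λ y x~y → p (transfer y) (q y x~y)

  transfer-cong : ∀ {x y} → x ≗ y → transfer x ≗ transfer y
  transfer-cong {x} {y} x≗y n = let N , p = transfer-locally-constant x (suc n) in
    p y (λ i _ → x≗y i) n ℕ.≤-refl

-- Measure preservation by the homeomorphism of matched trees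

pushforward : ProbabilityMeasure → ∀ {f} → Continuous f → ProbabilityMeasure
pushforward μ {f} f-cont = record
  { measure           = λ A → measure μ (preimage f-cont A)
  ; measure-cong      = λ { (A⊆B , B⊆A) → measure-cong μ (A⊆B , B⊆A) }
  ; nonnegative       = λ A → nonnegative μ (preimage f-cont A)
  -- The preimage has the same elements as `∅ᴮ` but another derivation of being Borel, so
  -- `measure-cong` has to mediate.
  ; measure-∅         = ≃⇒≈ (≃-trans {y = measure μ ∅ᴮ} (same ∅ᴮ (id , id)) (≈⇒≃ _ 0ℝ (measure-∅ μ)))
  ; measure-U         = ≃⇒≈ (≃-trans {y = measure μ Uᴮ} (same Uᴮ (id , id)) (≈⇒≃ _ 1ℝ (measure-U μ)))
  ; countablyAdditive = λ A disj → countablyAdditive μ (λ n → preimage f-cont (A n)) (λ m≢n → disj m≢n)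
  }
  where
  same : ∀ A → BorelSet.set (preimage f-cont A) ≐ BorelSet.set A →
    measure μ (preimage f-cont A) ≃ measure μ A
  same A e = ≈⇒≃ _ _ (measure-cong μ {preimage f-cont A} {A} e)

module TreeHomeo (em : ExcludedMiddle 0ℓ) (μ : ProbabilityMeasure) {m : ℕ}
  (S : Tree (Fin m) proj₁) (T : Tree (Fin m) proj₂)
  (S→T : ∀ t → Satisfiable (Clopen.set (cell S t)) → Satisfiable (Clopen.set (cell T t)))
  (T→S : ∀ t → Satisfiable (Clopen.set (cell T t)) → Satisfiable (Clopen.set (cell S t)))
  (same-measure : ∀ t → measureᶜ μ (cell S t) ≃ measureᶜ μ (cell T t))
  where

  open Sets em
  private
    module F = Transfer em S T S→T
    module B = Transfer em T S T→S
    module M = Measure μ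
    ν = pushforward μ F.transfer-continuous
    module N = Measure ν

    -- Transfer preserves paths, so the map back reads the `proj₁` labels along the path of `x`
    -- itself, and these are the bits of `x`.
    from-to : ∀ x → B.transfer (F.transfer x) ≗ x
    from-to x n = trans (cong proj₁ (F.transfer-step x n)) (sym (step-correct S x n))

    to-from : ∀ y → F.transfer (B.transfer y) ≗ y
    to-from y n = trans (cong proj₂ (B.transfer-step y n)) (sym (step-correct T y n))

    Equal : BorelSet → Set
    Equal A = measure ν A ≃ measure μ A

    Equal-≐ : ∀ A B → ⟦ A ⟧ ≐ ⟦ B ⟧ → Equal A → Equal B
    Equal-≐ A B (A⊆B , B⊆A) e = ≃-trans (N.meas-cong {B} {A} (B⊆A , A⊆B))
      (≃-trans e (M.meas-cong {A} {B} (A⊆B , B⊆A)))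

    Equal-∪ : ∀ A B → ⟦ A ⟧ ⊥ ⟦ B ⟧ → Equal A → Equal B → Equal (A ∪ᴮ B)
    Equal-∪ A B A⊥B a b = ≃-trans (N.meas-∪ A B A⊥B)
      (≃-trans (⊕-cong a b) (≃-sym (M.meas-∪ A B A⊥B)))

    Equal-∅ : ∀ A → (∀ x → x ∉ ⟦ A ⟧) → Equal A
    Equal-∅ A empty = ≃-trans (N.meas-∅ {A} empty) (≃-sym (M.meas-∅ {A} empty))

    ⋃ᶠ : ∀ {k} → (Fin k → BorelSet) → BorelSet
    ⋃ᶠ {zero}  A = ∅ᴮ
    ⋃ᶠ {suc k} A = A zero ∪ᴮ ⋃ᶠ (A ∘ suc)

    ∈-⋃ᶠ⁺ : ∀ {k x} (A : Fin k → BorelSet) i → x ∈ ⟦ A i ⟧ → x ∈ ⟦ ⋃ᶠ A ⟧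
    ∈-⋃ᶠ⁺ A zero    x∈ = inj₁ x∈
    ∈-⋃ᶠ⁺ A (suc i) x∈ = inj₂ (∈-⋃ᶠ⁺ (A ∘ suc) i x∈)

    ∈-⋃ᶠ⁻ : ∀ {k x} (A : Fin k → BorelSet) → x ∈ ⟦ ⋃ᶠ A ⟧ → ∃[ i ] x ∈ ⟦ A i ⟧
    ∈-⋃ᶠ⁻ {suc k} A (inj₁ x∈) = zero , x∈
    ∈-⋃ᶠ⁻ {suc k} A (inj₂ x∈) = let i , x∈A = ∈-⋃ᶠ⁻ (A ∘ suc) x∈ in suc i , x∈A

    Equal-⋃ᶠ : ∀ {k} (A : Fin k → BorelSet) → (∀ {i j} → i ≢ j → ⟦ A i ⟧ ⊥ ⟦ A j ⟧) →
      (∀ i → Equal (A i)) → Equal (⋃ᶠ A)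
    Equal-⋃ᶠ {zero}  A disj e = Equal-∅ ∅ᴮ (λ _ ())
    Equal-⋃ᶠ {suc k} A disj e = Equal-∪ (A zero) (⋃ᶠ (A ∘ suc))
      (λ { (x∈0 , x∈) → let i , x∈A = ∈-⋃ᶠ⁻ (A ∘ suc) x∈ in disj {zero} {suc i} (λ ()) (x∈0 , x∈A) })
      (e zero) (Equal-⋃ᶠ (A ∘ suc) (λ i≢j → disj (λ { refl → i≢j refl })) (e ∘ suc))

    -- The preimage of a right cell is exactly the left cell at the same node.
    Equal-cell : ∀ t → Equal (clopen⇒borel (cell T t))
    Equal-cell t = ≃-trans
      (M.meas-cong {preimage F.transfer-continuous (clopen⇒borel (cell T t))} {clopen⇒borel (cell S t)}
        (F.transfer-cell⁻ t , F.transfer-cell⁺ t))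
      (same-measure t)

    cell⇒agree : ∀ t {x y} → Clopen.set (cell T t) x → Clopen.set (cell T t) y → Agree (depth t) x y
    cell⇒agree (t ▹ c) x∈ y∈ i i<n with ℕ.m<1+n⇒m<n∨m≡n i<n
    ... | inj₁ i<n′ = cell⇒agree t (parent T t c x∈) (parent T t c y∈) i i<n′
    ... | inj₂ refl = trans (label-correct T t c x∈) (sym (label-correct T t c y∈))

    module _ (K : LevelSet) where
      open LevelSet K

      piece : Node (Fin m) → BorelSet
      piece t = borel ∩ᴮ clopen⇒borel (cell T t)

      piece-disjoint : ∀ t {c d} → c ≢ d → ⟦ piece (t ▹ c) ⟧ ⊥ ⟦ piece (t ▹ d) ⟧
      piece-disjoint t {c} {d} c≢d ((_ , x∈c) , (_ , x∈d)) = c≢d (child-unique T t c d x∈c x∈d)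

      -- Induction on the number `k` of levels still to descend. Once the depth reaches `level`, all
      -- points of a right cell share the bits that `K` depends on, so the piece is empty or the
      -- whole cell; before that, additivity over the four children applies.
      Equal-piece : ∀ k t → level ℕ.≤ depth t ℕ.+ k → Equal (piece t)
      Equal-piece zero t l≤ with em {Satisfiable ⟦ piece t ⟧}
      ... | no empty = Equal-∅ (piece t) (λ x x∈ → empty (x , x∈))
      ... | yes (z , z∈K , z∈t) = Equal-≐ (clopen⇒borel (cell T t)) (piece t)
              ((λ x∈t → invariant (Agree-mono l≤′ (cell⇒agree t z∈t x∈t)) z∈K , x∈t) , proj₂)
              (Equal-cell t)
        where l≤′ = subst (level ℕ.≤_) (ℕ.+-identityʳ (depth t)) l≤
      Equal-piece (suc k) t l≤ = Equal-≐ (half false ∪ᴮ half true) (piece t)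
        ((λ { (inj₁ (inj₁ x∈)) → up _ x∈ ; (inj₁ (inj₂ x∈)) → up _ x∈
            ; (inj₂ (inj₁ x∈)) → up _ x∈ ; (inj₂ (inj₂ x∈)) → up _ x∈ }) , down)
        (Equal-∪ (half false) (half true)
          (λ { (x∈ , y∈) → let c , x∈c = in-half false x∈ ; d , x∈d = in-half true y∈ in
                 piece-disjoint t {false , c} {true , d} (λ ()) (x∈c , x∈d) })
          (Equal-half false) (Equal-half true))
        where
        half : Bool → BorelSet
        half b = piece (t ▹ (b , false)) ∪ᴮ piece (t ▹ (b , true))
        in-half : ∀ b {x} → x ∈ ⟦ half b ⟧ → ∃[ c ] x ∈ ⟦ piece (t ▹ (b , c)) ⟧
        in-half b (inj₁ x∈) = false , x∈
        in-half b (inj₂ x∈) = true , x∈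
        Equal-half : ∀ b → Equal (half b)
        Equal-half b = Equal-∪ (piece (t ▹ (b , false))) (piece (t ▹ (b , true)))
          (piece-disjoint t (λ ())) (rec false) (rec true)
          where
          rec : ∀ c → Equal (piece (t ▹ (b , c)))
          rec c = Equal-piece k (t ▹ (b , c)) (subst (level ℕ.≤_) (ℕ.+-suc (depth t) k) l≤)
        up : ∀ c {x} → x ∈ ⟦ piece (t ▹ c) ⟧ → x ∈ ⟦ piece t ⟧
        up c (x∈K , x∈) = x∈K , parent T t c x∈
        down : ∀ {x} → x ∈ ⟦ piece t ⟧ → x ∈ ⟦ half false ∪ᴮ half true ⟧
        down (x∈K , x∈t) with child T t x∈t
        ... | (false , false) , x∈ = inj₁ (inj₁ (x∈K , x∈))
        ... | (false , true)  , x∈ = inj₁ (inj₂ (x∈K , x∈))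
        ... | (true  , false) , x∈ = inj₂ (inj₁ (x∈K , x∈))
        ... | (true  , true)  , x∈ = inj₂ (inj₂ (x∈K , x∈))

      Equal-level : Equal borel
      Equal-level = Equal-≐ (⋃ᶠ pieces) borel
        ((λ x∈ → proj₁ (proj₂ (∈-⋃ᶠ⁻ pieces x∈))) ,
         (λ {x} x∈K → let i , x∈i = root-of T x in ∈-⋃ᶠ⁺ pieces i (x∈K , x∈i)))
        (Equal-⋃ᶠ pieces (λ { i≢j ((_ , x∈i) , (_ , x∈j)) → i≢j (root-unique T x∈i x∈j) })
          (λ i → Equal-piece level (root i) ℕ.≤-refl))
        where
        pieces : Fin m → BorelSet
        pieces i = piece (root i)

  homeo : Homeo μ
  homeo = record
    { inverse = record
      { to        = F.transfer
      ; from      = B.transfer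
      ; to-cong   = F.transfer-cong
      ; from-cong = B.transfer-cong
      ; inverse   =
          (λ {x} {y} e n → trans (F.transfer-cong e n) (to-from x n)) ,
          (λ {x} {y} e n → trans (B.transfer-cong e n) (from-to x n))
      }
    ; to-continuous   = F.transfer-continuous
    ; from-continuous = B.transfer-continuous
    ; preserves       = λ A → ≃⇒≈ (Uniqueness.measures-agree em ν μ Equal-level A)
    }

  homeo-image : ∀ t → image (Homeo.to homeo) (Clopen.set (cell S t)) ≐ Clopen.set (cell T t)
  homeo-image t =
    (λ { {y} (x , x∈ , tx≗y) → clopen-≗ (cell T t) tx≗y (F.transfer-cell⁺ t x∈) }) ,
    (λ {y} y∈ → B.transfer y , B.transfer-cell⁺ t y∈ , to-from y)

-- Clopen sets and the subset condition

module ClopenSets (em : ExcludedMiddle 0ℓ) where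

  open Sets em

  ∥_∥ : Clopen → Subset
  ∥_∥ = Clopen.set

  ∁ᶜ : Clopen → Clopen
  ∁ᶜ V = record
    { set      = ∁ ∥ V ∥
    ; isOpen   = Clopen.isClosed V
    ; isClosed = λ x x∈ → let n , p = Clopen.isOpen V x (stable x∈) in n , λ y x~y y∉ → y∉ (p y x~y)
    }

  infixr 7 _∩ᶜ_

  _∩ᶜ_ : Clopen → Clopen → Clopen
  V ∩ᶜ W = record
    { set      = ∥ V ∥ ∩ ∥ W ∥
    ; isOpen   = λ x → λ { (x∈V , x∈W) →
        let m , p = Clopen.isOpen V x x∈V
            n , q = Clopen.isOpen W x x∈W
        in m ℕ.⊔ n , λ y x~y →
             p y (Agree-mono (ℕ.m≤m⊔n m n) x~y) , q y (Agree-mono (ℕ.m≤n⊔m m n) x~y) }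
    ; isClosed = closed
    }
    where
    closed : IsOpen (∁ (∥ V ∥ ∩ ∥ W ∥))
    closed x x∉ with em {x ∈ ∥ V ∥}
    ... | no x∉V  = let n , p = Clopen.isClosed V x x∉V in n , λ y x~y → p y x~y ∘ proj₁
    ... | yes x∈V = let n , p = Clopen.isClosed W x (λ x∈W → x∉ (x∈V , x∈W)) in
                    n , λ y x~y → p y x~y ∘ proj₂

  Uᶜ : Clopen
  Uᶜ = record
    { set      = BorelSet.set Uᴮ
    ; isOpen   = λ _ _ → 0 , λ _ _ → _
    ; isClosed = λ _ x∉ → ⊥-elim (x∉ _)
    }

  bit : ℕ → Clopen
  bit n = record
    { set      = λ x → x n ≡ true
    ; isOpen   = λ x e → suc n , λ y x~y → trans (sym (x~y n ℕ.≤-refl)) e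
    ; isClosed = λ x ¬e → suc n , λ y x~y e → ¬e (trans (x~y n ℕ.≤-refl) e)
    }

  side : Clopen → Bool → Clopen
  side V true  = V
  side V false = ∁ᶜ V

  decide-side : ∀ V x → ∃[ b ] x ∈ ∥ side V b ∥
  decide-side V x with em {x ∈ ∥ V ∥}
  ... | yes x∈ = true , x∈
  ... | no x∉  = false , x∉

  side-unique : ∀ V {x} b c → x ∈ ∥ side V b ∥ → x ∈ ∥ side V c ∥ → b ≡ c
  side-unique V false false _   _   = refl
  side-unique V true  true  _   _   = refl
  side-unique V false true  x∉V x∈V = ⊥-elim (x∉V x∈V)
  side-unique V true  false x∈V x∉V = ⊥-elim (x∉V x∈V)

  ∈-bit : ∀ n {x} b → x ∈ ∥ side (bit n) b ∥ → x n ≡ b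
  ∈-bit n     true  e = e
  ∈-bit n {x} false e with x n
  ... | true  = ⊥-elim (e refl)
  ... | false = refl

  module ClopenMeasure (μ : ProbabilityMeasure) where

    open Measure μ

    measᶜ-cong : ∀ {V W} → ∥ V ∥ ≐ ∥ W ∥ → measureᶜ μ V ≃ measureᶜ μ W
    measᶜ-cong {V} {W} e = meas-cong {clopen⇒borel V} {clopen⇒borel W} e

    measᶜ-split : ∀ V D → measureᶜ μ V ≃ measureᶜ μ (V ∩ᶜ D) ⊕ measureᶜ μ (V ∩ᶜ ∁ᶜ D)
    measᶜ-split V D = ≃-trans (meas-split (clopen⇒borel V) (clopen⇒borel D)) (⊕-cong
      (meas-cong {clopen⇒borel V ∩ᴮ clopen⇒borel D} {clopen⇒borel (V ∩ᶜ D)} (id , id))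
      (meas-cong {clopen⇒borel V ∩ᴮ ∁ᴮ (clopen⇒borel D)} {clopen⇒borel (V ∩ᶜ ∁ᶜ D)} (id , id)))

    measᶜ-diff : ∀ V W → ∥ W ∥ ⊆ ∥ V ∥ → measureᶜ μ V ≃ measureᶜ μ W ⊕ measureᶜ μ (V ∩ᶜ ∁ᶜ W)
    measᶜ-diff V W W⊆V = ≃-trans (measᶜ-split V W)
      (⊕-cong (measᶜ-cong {V ∩ᶜ W} {W} (proj₂ , (λ w → W⊆V w , w))) ≃-refl)

    measᶜ-mono : ∀ V W → ∥ V ∥ ⊆ ∥ W ∥ → measureᶜ μ V ≼ measureᶜ μ W
    measᶜ-mono V W V⊆W = meas-mono {clopen⇒borel V} {clopen⇒borel W} V⊆W

    measᶜ-nonneg : ∀ V → 0ℝ ≼ measureᶜ μ V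
    measᶜ-nonneg V = meas-nonneg (clopen⇒borel V)

    measᶜ-empty : ∀ V → (∀ x → x ∉ ∥ V ∥) → measureᶜ μ V ≃ 0ℝ
    measᶜ-empty V empty = meas-∅ {clopen⇒borel V} empty

    measᶜ-U : ∀ V → (∀ x → x ∈ ∥ V ∥) → measureᶜ μ V ≃ 1ℝ
    measᶜ-U V full = ≃-trans (meas-cong {clopen⇒borel V} {Uᴮ} ((λ _ → _) , (λ {x} _ → full x)))
      (≈⇒≃ _ _ (measure-U μ))

    module Fullness (full : Full μ) where

      null⇒empty : ∀ V → measureᶜ μ V ≃ 0ℝ → ∀ x → x ∉ ∥ V ∥
      null⇒empty V null x x∈ = ≺⇒⋡ (mk≺ (full ∥ V ∥ (Clopen.isOpen V) (x , x∈))) (≃⇒≼ null)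

      -- For a full measure a clopen set is empty exactly when it is null, so emptiness can be read
      -- off from the measure.
      nonempty-transport : ∀ V W → measureᶜ μ V ≃ measureᶜ μ W → Satisfiable ∥ V ∥ → Satisfiable ∥ W ∥
      nonempty-transport V W e (x , x∈) with em {Satisfiable ∥ W ∥}
      ... | yes w = w
      ... | no ¬w = ⊥-elim (null⇒empty V (≃-trans e (measᶜ-empty W λ y y∈ → ¬w (y , y∈))) x x∈)

-- Good measures are ultrahomogeneous

module GoodMeasure (em : ExcludedMiddle 0ℓ) (μ : ProbabilityMeasure)
  (full : Full μ) (subset-condition : SubsetCondition μ) where

  open Sets em using (stable)
  open ClopenSets em
  open ClopenMeasure μ
  open Fullness full

  -- The subset condition covers strict inequality; for equal measures `W` itself serves.
  carve : ∀ V W → measureᶜ μ V ≼ measureᶜ μ W →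
    Σ[ E ∈ Clopen ] ∥ E ∥ ⊆ ∥ W ∥ × measureᶜ μ E ≃ measureᶜ μ V
  carve V W V≼W with compare em (measureᶜ μ V) (measureᶜ μ W)
  ... | less V<W    = let E , E⊆W , e = subset-condition V W (unwrap V<W) in E , E⊆W , ≈⇒≃ _ _ e
  ... | equal V≃W   = W , id , ≃-sym V≃W
  ... | greater W<V = ⊥-elim (≺⇒⋡ W<V V≼W)

  -- A copy `E` of `V ∩ᶜ D` is carved out of `W`; the outer pieces then match by cancelling the
  -- inner ones from the equal totals.
  match-cut : ∀ V W → measureᶜ μ V ≃ measureᶜ μ W → ∀ D →
    Σ[ E ∈ Clopen ] ∀ b → measureᶜ μ (V ∩ᶜ side D b) ≃ measureᶜ μ (W ∩ᶜ side E b)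
  match-cut V W V≃W D = E , λ { true → inner ; false → outer }
    where
    carved : Σ[ E ∈ Clopen ] ∥ E ∥ ⊆ ∥ W ∥ × measureᶜ μ E ≃ measureᶜ μ (V ∩ᶜ D)
    carved = carve (V ∩ᶜ D) W (≼-trans (measᶜ-mono (V ∩ᶜ D) V proj₁) (≃⇒≼ V≃W))
    E = proj₁ carved
    inner : measureᶜ μ (V ∩ᶜ D) ≃ measureᶜ μ (W ∩ᶜ E)
    inner = ≃-trans (≃-sym (proj₂ (proj₂ carved)))
      (measᶜ-cong {E} {W ∩ᶜ E} ((λ x∈ → proj₁ (proj₂ carved) x∈ , x∈) , proj₂))
    outer : measureᶜ μ (V ∩ᶜ ∁ᶜ D) ≃ measureᶜ μ (W ∩ᶜ ∁ᶜ E)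
    outer = ⊕-cancelˡ inner (≃-trans (≃-sym (measᶜ-split V D)) (≃-trans V≃W (measᶜ-split W E)))

  record Match : Set₁ where
    field
      left right : Clopen
      balanced   : measureᶜ μ left ≃ measureᶜ μ right
  open Match

  -- First cut both sides along the bit n of the left, then along the bit n
  -- of the right.

  module Refine (M : Match) (n : ℕ) where
    right-cut : Σ[ E ∈ Clopen ] ∀ b →
      measureᶜ μ (left M ∩ᶜ side (bit n) b) ≃ measureᶜ μ (right M ∩ᶜ side E b)
    right-cut = match-cut (left M) (right M) (balanced M) (bit n)

    left₁ right₁ : Bool → Clopen
    left₁ b  = left M ∩ᶜ side (bit n) b
    right₁ b = right M ∩ᶜ side (proj₁ right-cut) b

    left-cut : ∀ b → Σ[ E ∈ Clopen ] ∀ c →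
      measureᶜ μ (right₁ b ∩ᶜ side (bit n) c) ≃ measureᶜ μ (left₁ b ∩ᶜ side E c)
    left-cut b = match-cut (right₁ b) (left₁ b) (≃-sym (proj₂ right-cut b)) (bit n)

    refined : Bool × Bool → Match
    refined (b , c) = record
      { left     = left₁ b ∩ᶜ side (proj₁ (left-cut b)) c
      ; right    = right₁ b ∩ᶜ side (bit n) c
      ; balanced = ≃-sym (proj₂ (left-cut b) c)
      }

  module MatchedTrees {m n} (P : ClopenPartition m) (R : ClopenPartition n) (f : Fin m ⤖ Fin n)
    (same : ∀ i → measureᶜ μ (part P i) ≃ measureᶜ μ (part R (Bijection.to f i))) where

    match : Node (Fin m) → Match
    match (root i) = record { left = part P i ; right = part R (Bijection.to f i) ; balanced = same i }
    match (t ▹ c)  = Refine.refined (match t) (depth t) c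

    same-part : ∀ {k} (Q : ClopenPartition k) {i j x} →
      x ∈ ∥ part Q i ∥ → x ∈ ∥ part Q j ∥ → i ≡ j
    same-part Q x∈i x∈j = stable λ i≢j → disjoint Q i≢j (x∈i , x∈j)

    -- One shape serves both trees. On the left `G` is the bit and `H` the copied cut, which depends
    -- on the first side; on the right `G` is the copied cut and `H` is constantly the bit.
    twice : ∀ X (G : Clopen) (H : Bool → Clopen) {x} → x ∈ ∥ X ∥ →
      Σ[ bc ∈ Bool × Bool ] x ∈ ∥ (X ∩ᶜ side G (proj₁ bc)) ∩ᶜ side (H (proj₁ bc)) (proj₂ bc) ∥
    twice X G H {x} x∈ with decide-side G x
    ... | b , x∈G with decide-side (H b) x
    ...   | c , x∈H = (b , c) , (x∈ , x∈G) , x∈H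

    twice-unique : ∀ X (G : Clopen) (H : Bool → Clopen) {x} b c d e →
      x ∈ ∥ (X ∩ᶜ side G b) ∩ᶜ side (H b) c ∥ → x ∈ ∥ (X ∩ᶜ side G d) ∩ᶜ side (H d) e ∥ →
      (b , c) ≡ (d , e)
    twice-unique X G H b c d e ((_ , x∈b) , x∈c) ((_ , x∈d) , x∈e)
      with refl ← side-unique G b d x∈b x∈d
      with refl ← side-unique (H b) c e x∈c x∈e = refl

    S : Tree (Fin m) proj₁
    S = record
      { cell          = λ t → left (match t)
      ; root-of       = covers P
      ; root-unique   = same-part P
      ; parent        = λ { t c ((x∈ , _) , _) → x∈ }
      ; child         = λ t → let open Refine (match t) (depth t) in
                          twice (left (match t)) (bit (depth t)) (proj₁ ∘ left-cut)
      ; child-unique  = λ { t (b , c) (d , e) → let open Refine (match t) (depth t) in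
                          twice-unique (left (match t)) (bit (depth t)) (proj₁ ∘ left-cut) b c d e }
      ; label-correct = λ { t (b , c) ((_ , x∈) , _) → ∈-bit (depth t) b x∈ }
      }

    T : Tree (Fin m) proj₂
    T = record
      { cell          = λ t → right (match t)
      -- The right roots are members of `R` but carry the indices of `P`, so the index found in `R`
      -- is pulled back along `f`.
      ; root-of       = λ x → let j , x∈ = covers R x ; i , e = Bijection.strictlySurjective f j in
                          i , subst (λ k → x ∈ ∥ part R k ∥) (sym e) x∈
      ; root-unique   = λ x∈i x∈j → Bijection.injective f (same-part R x∈i x∈j)
      ; parent        = λ { t c ((x∈ , _) , _) → x∈ }
      ; child         = λ t → let open Refine (match t) (depth t) in
                          twice (right (match t)) (proj₁ right-cut) (λ _ → bit (depth t))
      ; child-unique  = λ { t (b , c) (d , e) → let open Refine (match t) (depth t) in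
                          twice-unique (right (match t)) (proj₁ right-cut) (λ _ → bit (depth t)) b c d e }
      ; label-correct = λ { t (b , c) (_ , x∈) → ∈-bit (depth t) c x∈ }
      }

    open TreeHomeo em μ S T
      (λ t → nonempty-transport (left (match t)) (right (match t)) (balanced (match t)))
      (λ t → nonempty-transport (right (match t)) (left (match t)) (≃-sym (balanced (match t))))
      (λ t → balanced (match t))
      public

  ultrahomogeneous : Ultrahomogeneous μ
  ultrahomogeneous = full , λ P R f same →
    let open MatchedTrees P R f (λ i → ≈⇒≃ _ _ (same i)) in
    homeo , λ i → homeo-image (root i)

  -- Good measures are maximal

  record Division {n} (B : Clopen) (v : Fin n → ℝ) : Set₁ where
    field
      piece    : Fin n → Clopen
      inside   : ∀ i → ∥ piece i ∥ ⊆ ∥ B ∥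
      values   : ∀ i → measureᶜ μ (piece i) ≃ v i
      apart    : ∀ {i j} → i ≢ j → ∥ piece i ∥ ⊥ ∥ piece j ∥
      covering : ∀ {x} → x ∈ ∥ B ∥ → ∃[ i ] x ∈ ∥ piece i ∥

  cons : ∀ {n} {B} {v : Fin (suc n) → ℝ} →
    (Σ[ E ∈ Clopen ] ∥ E ∥ ⊆ ∥ B ∥ × measureᶜ μ E ≃ v zero × Division (B ∩ᶜ ∁ᶜ E) (v ∘ suc)) →
    Division B v
  cons {n} {B} {v} (E , E⊆B , E≃v , rest) = record
    { piece    = pieces
    ; inside   = λ { zero → E⊆B ; (suc i) x∈ → proj₁ (inside i x∈) }
    ; values   = λ { zero → E≃v ; (suc i) → values i }
    ; apart    = apart′
    ; covering = cover
    }
    where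
    open Division rest
    pieces : Fin (suc n) → Clopen
    pieces zero    = E
    pieces (suc i) = piece i
    apart′ : ∀ {i j} → i ≢ j → ∥ pieces i ∥ ⊥ ∥ pieces j ∥
    apart′ {zero}  {zero}  i≢j _         = i≢j refl
    apart′ {zero}  {suc j} _   (x∈ , y∈) = proj₂ (inside j y∈) x∈
    apart′ {suc i} {zero}  _   (x∈ , y∈) = proj₂ (inside i x∈) y∈
    apart′ {suc i} {suc j} i≢j           = apart (λ { refl → i≢j refl })
    cover : ∀ {x} → x ∈ ∥ B ∥ → ∃[ i ] x ∈ ∥ pieces i ∥
    cover {x} x∈B with em {x ∈ ∥ E ∥}
    ... | yes x∈E = zero , x∈E
    ... | no x∉E  = let i , x∈ = covering (x∈B , x∉E) in suc i , x∈

  sum-nonneg : ∀ {n} (v : Fin n → ℝ) → (∀ i → v i ∈ ClopenValues μ) → 0ℝ ≼ sum v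
  sum-nonneg {zero}  v v∈ = ≃⇒≽ (sum-zero v)
  sum-nonneg {suc n} v v∈ with v∈ zero
  ... | V , V≈v = ≼-trans (sum-nonneg (v ∘ suc) (v∈ ∘ suc)) (≼-trans
    (x≼x⊕y (≼-trans (measᶜ-nonneg V) (≃⇒≼ (≈⇒≃ (measureᶜ μ V) (v zero) V≈v))))
    (≃⇒≼ (≃-trans (⊕-comm _ _) (≃-sym (sum-suc v)))))

  -- Pieces are carved off greedily. The first value is at most the measure of `B` because the
  -- others are nonnegative, and cancellation shows that the remainder has measure the sum of the
  -- others. This recursion is why divisions of an arbitrary clopen `B` are considered. At the end
  -- `B` is null, hence empty by fullness.
  divide : ∀ {n} (v : Fin n → ℝ) (B : Clopen) →
    (∀ i → v i ∈ ClopenValues μ) → measureᶜ μ B ≃ sum v → Division B v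
  divide {zero} v B v∈ B≃ = record
    { piece = λ () ; inside = λ () ; values = λ () ; apart = λ { {()} }
    ; covering = λ {x} x∈ → ⊥-elim (null⇒empty B (≃-trans B≃ (sum-zero v)) x x∈)
    }
  divide {suc n} v B v∈ B≃ = first (v∈ zero)
    where
    first : v zero ∈ ClopenValues μ → Division B v
    first (V , V≈v) = split (carve V B (≼-trans (≃⇒≼ V≃v)
        (≼-trans (x≼x⊕y (sum-nonneg (v ∘ suc) (v∈ ∘ suc))) (≃⇒≽ (≃-trans B≃ (sum-suc v))))))
      where
      V≃v : measureᶜ μ V ≃ v zero
      V≃v = ≈⇒≃ _ _ V≈v
      split : Σ[ E ∈ Clopen ] ∥ E ∥ ⊆ ∥ B ∥ × measureᶜ μ E ≃ measureᶜ μ V → Division B v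
      split (E , E⊆B , E≃V) = cons (E , E⊆B , ≃-trans E≃V V≃v ,
        divide (v ∘ suc) (B ∩ᶜ ∁ᶜ E) (v∈ ∘ suc) (⊕-cancelˡ (≃-trans E≃V V≃v)
          (≃-trans (≃-sym (measᶜ-diff B E E⊆B)) (≃-trans B≃ (sum-suc v)))))

  maximal : Maximal μ
  maximal = record
    { realizes = λ v v∈ v≢0 ∑v≈1 → partition v v≢0 (divide v Uᶜ v∈ (≃-trans (measᶜ-U Uᶜ (λ _ → _))
        (≃-sym (≃-trans (sum≃∑ v) (≈⇒≃ (∑ v) 1ℝ ∑v≈1)))))
    ; difference = λ { v w (V , V≈v) (W , W≈w) → difference′ V W (≈⇒≃ _ v V≈v) (≈⇒≃ _ w W≈w) }
    }
    where
    partition : ∀ {n} (v : Fin n → ℝ) → (∀ i → ¬ (v i ≈ 0ℝ)) → Division Uᶜ v →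
      Σ[ P ∈ ClopenPartition n ] ∀ i → measureᶜ μ (part P i) ≈ v i
    partition v v≢0 division = record
      { part     = piece
      ; nonempty = λ i → stable λ empty → v≢0 i (≃⇒≈ (≃-trans (≃-sym (values i))
                     (measᶜ-empty (piece i) λ x x∈ → empty (x , x∈))))
      ; disjoint = apart
      ; covers   = λ x → covering {x} _
      } , λ i → ≃⇒≈ (values i)
      where open Division division
    -- The difference is realized by removing from `W` a carved copy of `V`.
    ordered : ∀ V W {v w} → measureᶜ μ V ≃ v → measureᶜ μ W ≃ w → measureᶜ μ V ≼ measureᶜ μ W →
      Σ[ D ∈ Clopen ] measureᶜ μ D ≃ ∣ w - v ∣
    ordered V W {v} {w} V≃v W≃w V≼W with carve V W V≼W
    ... | E , E⊆W , E≃V = W ∩ᶜ ∁ᶜ E , ≃-trans (≃-sym (0≼x⇒∣x∣≃x (measᶜ-nonneg (W ∩ᶜ ∁ᶜ E))))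
          (∣-∣-cong (≃-trans (⊕-cancelˡ (≃-trans E≃V V≃v)
            (≃-trans (≃-sym (measᶜ-diff W E E⊆W)) (≃-trans W≃w (≃-sym (⊕-⊖-cancel v w)))))
            (⊖≃- w v)))
    difference′ : ∀ V W {v w} → measureᶜ μ V ≃ v → measureᶜ μ W ≃ w → ∣ v - w ∣ ∈ ClopenValues μ
    difference′ V W {v} {w} V≃v W≃w with compare em (measureᶜ μ W) (measureᶜ μ V)
    ... | less W<V    = let D , e = ordered W V W≃w V≃v (≺⇒≼ W<V) in D , ≃⇒≈ e
    ... | equal W≃V   = let D , e = ordered W V W≃w V≃v (≃⇒≼ W≃V) in D , ≃⇒≈ e
    ... | greater V<W = let D , e = ordered V W V≃v W≃w (≺⇒≼ V<W) in
                        D , ≃⇒≈ (≃-trans e (∣x-y∣-comm w v))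

-- Ultrahomogeneous maximal measures are good

module Converse (em : ExcludedMiddle 0ℓ) (μ : ProbabilityMeasure)
  (ultrahomogeneous : Ultrahomogeneous μ) (maximal : Maximal μ) where

  open Sets em using (stable; module Measure)
  open ClopenSets em
  open ClopenMeasure μ
  open Fullness (proj₁ ultrahomogeneous)
  open Maximal maximal

  whole : ∀ V → 1ℝ ≃ measureᶜ μ V ⊕ measureᶜ μ (∁ᶜ V)
  whole V = ≃-trans (≃-sym (measᶜ-U Uᶜ λ _ → _)) (≃-trans (measᶜ-split Uᶜ V)
    (⊕-cong (measᶜ-cong {Uᶜ ∩ᶜ V} {V} (proj₂ , (λ x∈ → _ , x∈)))
            (measᶜ-cong {Uᶜ ∩ᶜ ∁ᶜ V} {∁ᶜ V} (proj₂ , (λ x∈ → _ , x∈)))))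

  ∁ᶜ-measure : ∀ V W → measureᶜ μ V ≃ measureᶜ μ W → measureᶜ μ (∁ᶜ V) ≃ measureᶜ μ (∁ᶜ W)
  ∁ᶜ-measure V W V≃W = ⊕-cancelˡ V≃W (≃-trans (≃-sym (whole V)) (whole W))

  bipartition : ∀ V → Satisfiable ∥ V ∥ → Satisfiable ∥ ∁ᶜ V ∥ → ClopenPartition 2
  bipartition V inhabited coinhabited = record
    { part     = sides
    ; nonempty = λ { zero → inhabited ; (suc zero) → coinhabited }
    ; disjoint = sides-disjoint
    ; covers   = cover
    }
    where
    sides : Fin 2 → Clopen
    sides zero       = V
    sides (suc zero) = ∁ᶜ V
    sides-disjoint : ∀ {i j} → i ≢ j → ∥ sides i ∥ ⊥ ∥ sides j ∥
    sides-disjoint {zero}     {zero}     i≢j _         = i≢j refl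
    sides-disjoint {zero}     {suc zero} _   (x∈ , x∉) = x∉ x∈
    sides-disjoint {suc zero} {zero}     _   (x∉ , x∈) = x∉ x∈
    sides-disjoint {suc zero} {suc zero} i≢j _         = i≢j refl
    cover : ∀ x → ∃[ i ] x ∈ ∥ sides i ∥
    cover x with em {x ∈ ∥ V ∥}
    ... | yes x∈ = zero , x∈
    ... | no x∉  = suc zero , x∉

  -- The partitions of the space into `V` and its complement and into `B` and its complement have
  -- matching measures, so some automorphism carries `V` onto `B`. The set `W` is the image of `X`,
  -- written as a preimage under the inverse so that continuity makes it clopen.
  transport : ∀ V B X → Satisfiable ∥ V ∥ → Satisfiable ∥ ∁ᶜ V ∥ →
    Satisfiable ∥ B ∥ → Satisfiable ∥ ∁ᶜ B ∥ →
    measureᶜ μ V ≃ measureᶜ μ B → ∥ X ∥ ⊆ ∥ V ∥ →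
    Σ[ W ∈ Clopen ] ∥ W ∥ ⊆ ∥ B ∥ × measureᶜ μ W ≃ measureᶜ μ X
  transport V B X v v′ b b′ V≃B X⊆V = W , W⊆B , W≃X
    where
    automorphism = proj₂ ultrahomogeneous (bipartition V v v′) (bipartition B b b′) (⤖-id (Fin 2))
      (λ { zero → ≃⇒≈ V≃B ; (suc zero) → ≃⇒≈ (∁ᶜ-measure V B V≃B) })
    open Homeo (proj₁ automorphism)
    W : Clopen
    W = record
      { set      = from ⊢ ∥ X ∥
      ; isOpen   = from-continuous (Clopen.isOpen X)
      ; isClosed = from-continuous (Clopen.isClosed X)
      }
    W⊆B : ∥ W ∥ ⊆ ∥ B ∥
    W⊆B {y} y∈W = proj₁ (proj₂ automorphism zero) (from y , X⊆V y∈W , Inverse.strictlyInverseˡ inverse y)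
    W≃X : measureᶜ μ W ≃ measureᶜ μ X
    W≃X = ≃-trans (≃-sym (≈⇒≃ _ _ (preserves (clopen⇒borel W))))
      (Measure.meas-cong μ {preimage to-continuous (clopen⇒borel W)} {clopen⇒borel X}
        ((λ {x} → clopen-≗ X (Inverse.strictlyInverseʳ inverse x)) ,
         (λ {x} → clopen-≗ X (λ n → sym (Inverse.strictlyInverseʳ inverse x n)))))

  nondegenerate : ∀ A B → measureᶜ μ A ≺ measureᶜ μ B → Satisfiable ∥ A ∥ → Satisfiable ∥ ∁ᶜ B ∥ →
    Σ[ W ∈ Clopen ] ∥ W ∥ ⊆ ∥ B ∥ × measureᶜ μ W ≃ measureᶜ μ A
  nondegenerate A B A<B (x , x∈A) (y , y∉B) =
    -- The union of the first two members of `Q` is taken as the complement of the third, whose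
    -- measure is that of `∁ᶜ B`; hence `∁ᶜ X₂` has the measure of `B`.
    let W , W⊆B , W≃X = transport (∁ᶜ X₂) B X₀ (sat₀ , X₀⊆ x₀∈) (sat₂ , λ x∉ → x∉ x₂∈)
          (nonempty-transport (∁ᶜ X₂) B V≃B (sat₀ , X₀⊆ x₀∈)) (y , y∉B) V≃B X₀⊆
    in W , W⊆B , ≃-trans W≃X (≈⇒≃ _ _ (proj₂ realized zero))
    where
    a = measureᶜ μ A
    b = measureᶜ μ B
    gap = difference b a (B , ≈-refl b) (A , ≈-refl a)
    D = proj₁ gap
    a⊕D≃b : a ⊕ measureᶜ μ D ≃ b
    a⊕D≃b = ≃-trans (⊕-cong ≃-refl (≃-trans (≈⇒≃ _ _ (proj₂ gap)) (≃-trans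
      (∣-∣-cong (≃-sym (⊖≃- b a))) (0≼x⇒∣x∣≃x (0≼⊖ (≺⇒≼ A<B)))))) (⊕-⊖-cancel a b)
      where
      0≼⊖ : ∀ {x y} → x ≼ y → 0ℝ ≼ y ⊖ x
      0≼⊖ {x} x≼y = ≼-trans (≃⇒≽ (⊕-⊖ x 0ℝ)) (⊖-mono-≼ (≼-trans (≃⇒≼ (⊕-identityʳ x)) x≼y))
    pieces : Fin 3 → Clopen
    pieces zero             = A
    pieces (suc zero)       = D
    pieces (suc (suc zero)) = ∁ᶜ B
    pieces-nonzero : ∀ i → ¬ (measureᶜ μ (pieces i) ≈ 0ℝ)
    pieces-nonzero zero             e = null⇒empty A (≈⇒≃ _ _ e) x x∈A
    -- A null `D` would force `a` and `b` to be equal.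
    pieces-nonzero (suc zero)       e = ≺⇒⋡ A<B (≃⇒≼ (≃-trans (≃-sym a⊕D≃b)
      (≃-trans (⊕-cong ≃-refl (≈⇒≃ _ _ e)) (⊕-identityʳ a))))
    pieces-nonzero (suc (suc zero)) e = null⇒empty (∁ᶜ B) (≈⇒≃ _ _ e) y y∉B
    v : Fin 3 → ℝ
    v i = measureᶜ μ (pieces i)
    sum≃1 : sum v ≃ 1ℝ
    sum≃1 = ≃-trans (sum-three v) (≃-trans (⊕-cong a⊕D≃b ≃-refl) (≃-sym (whole B)))
    realized = realizes v (λ i → pieces i , ≈-refl (v i)) pieces-nonzero
      (≃⇒≈ (≃-trans (≃-sym (sum≃∑ v)) sum≃1))
    Q = proj₁ realized
    X₀ = part Q zero
    X₂ = part Q (suc (suc zero))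
    sat₀ = proj₁ (nonempty Q zero)
    x₀∈ : sat₀ ∈ ∥ X₀ ∥
    x₀∈ = proj₂ (nonempty Q zero)
    sat₂ = proj₁ (nonempty Q (suc (suc zero)))
    x₂∈ : sat₂ ∈ ∥ X₂ ∥
    x₂∈ = proj₂ (nonempty Q (suc (suc zero)))
    X₀⊆ : ∥ X₀ ∥ ⊆ ∥ ∁ᶜ X₂ ∥
    X₀⊆ z∈₀ z∈₂ = disjoint Q {zero} {suc (suc zero)} (λ ()) (z∈₀ , z∈₂)
    V≃B : measureᶜ μ (∁ᶜ X₂) ≃ b
    V≃B = ≃-trans (∁ᶜ-measure X₂ (∁ᶜ B) (≈⇒≃ _ _ (proj₂ realized (suc (suc zero)))))
      (measᶜ-cong {∁ᶜ (∁ᶜ B)} {B} (stable , (λ x∈ x∉ → x∉ x∈)))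

  -- Maximality realizes nonzero values only, so the cases where `A` is empty or `B` is the whole
  -- space are split off; in both of them `A` already lies in `B`.
  subset-condition : SubsetCondition μ
  subset-condition A B A<B with em {Satisfiable ∥ A ∥} | em {Satisfiable ∥ ∁ᶜ B ∥}
  ... | no empty | _ = A , (λ {x} x∈ → ⊥-elim (empty (x , x∈))) , ≈-refl (measureᶜ μ A)
  ... | yes _ | no full = A , (λ {x} _ → stable λ x∉B → full (x , x∉B)) , ≈-refl (measureᶜ μ A)
  ... | yes s | yes t = let W , W⊆B , e = nondegenerate A B (mk≺ A<B) s t in W , W⊆B , ≃⇒≈ e

theorem1 : ExcludedMiddle 0ℓ → (μ : ProbabilityMeasure) → Full μ →
    Good μ ⇔ (Ultrahomogeneous μ × Maximal μ)
theorem1 em μ full = mk⇔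
  (λ { (_ , sc) → GoodMeasure.ultrahomogeneous em μ full sc , GoodMeasure.maximal em μ full sc })
  (λ { (u , m) → full , Converse.subset-condition em μ u m })
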